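{- The derivability problems for each of the multiplicative fragments $\mathcal{F}^{\mathrm{mult}}_{2015}$, $\mathcal{F}^{\mathrm{mult}}_{2018}$ and $\mathcal{F}^{ -,\mathrm{mult}}_{2018}$ of the stoup-free calculi defined below are algorithmically undecidable.
   Context: Formulae are built from a countable set of variables and the constant $\mathbf{1}$ by the binary connectives $\backslash$, $/$, $\cdot$, $\wedge$, $\vee$ and the unary connectives $\langle\rangle$, $[]^{ -1}$ (bracket modalities) and $!$. A tree term is a formula or an expression $[\Xi]$ with $\Xi$ a meta-formula; a meta-formula is a finite linearly ordered sequence of tree terms (the empty sequence is $\Lambda$). A sequent is $\Xi\to C$, $\Xi$ a meta-formula, $C$ a formula. $\Xi(\Theta)$ denotes a meta-formula with a designated occurrence of a meta-formula $\Theta$ that is either $\Xi$ itself or the full content of some bracket $[\Theta]$ at any depth in $\Xi$; $\Xi(\Theta')$ is the result of replacing it. Common axioms and rules ($A,B,C,D,A_i$ formulae, $\Gamma,\Delta,\Delta_i,\Gamma_i,\Phi,\Pi$ sequences of tree terms): axioms $A\to A$, $\Lambda\to\mathbf1$; ($/L$) from $\Gamma\to B$ and $\Xi(\Delta_1,C,\Delta_2)\to D$ infer $\Xi(\Delta_1,C/B,\Gamma,\Delta_2)\to D$; ($/R$) from $\Gamma,B\to C$ infer $\Gamma\to C/B$; ($\backslash L$) from $\Gamma\to A$ and $\Xi(\Delta_1,C,\Delta_2)\to D$ infer $\Xi(\Delta_1,\Gamma,A\backslash C,\Delta_2)\to D$; ($\backslash R$) from $A,\Gamma\to C$ infer $\Gamma\to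 A\backslash C$; ($\cdot L$) from $\Xi(\Delta_1,A,B,\Delta_2)\to D$ infer $\Xi(\Delta_1,A\cdot B,\Delta_2)\to D$; ($\cdot R$) from $\Delta\to A$ and $\Gamma\to B$ infer $\Delta,\Gamma\to A\cdot B$; ($\mathbf1L$) from $\Xi(\Delta_1,\Delta_2)\to A$ infer $\Xi(\Delta_1,\mathbf1,\Delta_2)\to A$; ($\vee L$) from $\Xi(\Delta_1,A_1,\Delta_2)\to C$ and $\Xi(\Delta_1,A_2,\Delta_2)\to C$ infer $\Xi(\Delta_1,A_1\vee A_2,\Delta_2)\to C$; ($\vee R_i$) from $\Xi\to A_i$ infer $\Xi\to A_1\vee A_2$; ($\wedge L_i$) from $\Xi(\Delta_1,A_i,\Delta_2)\to C$ infer $\Xi(\Delta_1,A_1\wedge A_2,\Delta_2)\to C$; ($\wedge R$) from $\Xi\to A_1$ and $\Xi\to A_2$ infer $\Xi\to A_1\wedge A_2$; ($[]^{ -1}L$) from $\Xi(\Delta_1,A,\Delta_2)\to B$ infer $\Xi(\Delta_1,[[]^{ -1}A],\Delta_2)\to B$; ($[]^{ -1}R$) from $[\Xi]\to A$ infer $\Xi\to[]^{ -1}A$; ($\langle\rangle L$) from $\Xi(\Delta_1,[A],\Delta_2)\to B$ infer $\Xi(\Delta_1,\langle\rangle A,\Delta_2)\to B$; ($\langle\rangle R$) from $\Xi\to A$ infer $[\Xi]\to\langle\rangle A$; ($!L$) from $\Xi(\Delta_1,A,\Delta_2)\to C$ infer $\Xi(\Delta_1,!A,\Delta_2)\to C$;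 ($!P_1$) from $\Xi(\Delta_1,!A,\Phi,\Delta_2)\to C$ infer $\Xi(\Delta_1,\Phi,!A,\Delta_2)\to C$; ($!P_2$) from $\Xi(\Delta_1,\Phi,!A,\Delta_2)\to C$ infer $\Xi(\Delta_1,!A,\Phi,\Delta_2)\to C$; (cut) from $\Pi\to A$ and $\Xi(\Gamma_1,A,\Gamma_2)\to C$ infer $\Xi(\Gamma_1,\Pi,\Gamma_2)\to C$. $\mathcal{F}_{2015}$: common rules plus ($!R$) from $!A_1,\dots,!A_n\to B$ infer $!A_1,\dots,!A_n\to !B$ ($n\ge1$) and ($!C$) from $\Xi(!A_1,\dots,!A_n,\Gamma_1,[!A_1,\dots,!A_n,\Gamma_2],\Gamma_3)\to C$ infer $\Xi(!A_1,\dots,!A_n,\Gamma_1,\Gamma_2,\Gamma_3)\to C$ ($n\ge1$). $\mathcal{F}_{2018}$: common rules plus ($!R$) from $!A\to B$ infer $!A\to!B$ and ($!C$) from $\Xi(!A,\Gamma_1,[!A,\Gamma_2],\Gamma_3)\to C$ infer $\Xi(!A,\Gamma_1,[[\Gamma_2]],\Gamma_3)\to C$. $\mathcal{F}^{ - }_{2018}$ (Lambek's restriction): $\mathcal{F}_{2018}$ restricted to formulae without $\mathbf1$, without the axiom $\Lambda\to\mathbf1$ and rule $\mathbf1L$, with $\backslash R$ and $/R$ allowed only if $\Gamma\ne\Lambda$ and $!C$ allowed only if $\Gamma_2\neq\Lambda$. The multiplicative fragment (superscript $\mathrm{mult}$) of a calculus uses only formulae without $\wedge,\vee$ and omits the rules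 for $\wedge,\vee$. The derivability problem asks, given a sequent, whether it is derivable. -}

module Defs where

open import Data.Bool using (Bool; true; false; T)
open import Data.Fin using (Fin)
open import Data.List using (List; []; _∷_; _++_; map)
open import Data.Nat using (ℕ; suc; _+_; _*_; _^_; _<_)
open import Data.Product using (∃; _×_)
open import Data.Vec using (Vec; []; _∷_; lookup)
open import Data.Vec.Relation.Binary.Pointwise.Inductive using (Pointwise)
open import Relation.Binary.PropositionalEquality using (_≢_)
open import Relation.Nullary using (¬_)

data System : Set where
  F₂₀₁₅ F₂₀₁₈ F₂₀₁₈⁻ : System

data Fragment : Set where
  full mult : Fragment

lambekRestricted : System → Bool
lambekRestricted F₂₀₁₅  = false
lambekRestricted F₂₀₁₈  = false
lambekRestricted F₂₀₁₈⁻ = true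

hasUnit : System → Bool
hasUnit F₂₀₁₅  = true
hasUnit F₂₀₁₈  = true
hasUnit F₂₀₁₈⁻ = false

rules2015 : System → Bool
rules2015 F₂₀₁₅  = true
rules2015 F₂₀₁₈  = false
rules2015 F₂₀₁₈⁻ = false

rules2018 : System → Bool
rules2018 F₂₀₁₅  = false
rules2018 F₂₀₁₈  = true
rules2018 F₂₀₁₈⁻ = true

hasAdditives : Fragment → Bool
hasAdditives full = true
hasAdditives mult = false

infixr 7 _∖_
infixl 7 _/_
infixl 8 _·_
infixl 6 _∧_ _∨_
infix  9 ⟨⟩_ []⁻¹_ !_

-- A connective absent from the language cannot be formed: its guard is
-- then the empty type.  When it is present, the guard is solved by η.
data Formula (S : System) (F : Fragment) : Set where
  var   : ℕ → Formula S F
  𝟏     : {u : T (hasUnit S)} → Formula S F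
  _∖_   : Formula S F → Formula S F → Formula S F
  _/_   : Formula S F → Formula S F → Formula S F
  _·_   : Formula S F → Formula S F → Formula S F
  _∧_   : {a : T (hasAdditives F)} → Formula S F → Formula S F → Formula S F
  _∨_   : {a : T (hasAdditives F)} → Formula S F → Formula S F → Formula S F
  ⟨⟩_   : Formula S F → Formula S F
  []⁻¹_ : Formula S F → Formula S F
  !_    : Formula S F → Formula S F

data TreeTerm (S : System) (F : Fragment) : Set where
  fm  : Formula S F → TreeTerm S F
  [_] : List (TreeTerm S F) → TreeTerm S F

MetaFormula : System → Fragment → Set
MetaFormula S F = List (TreeTerm S F)

infix 3 _⟶_

record Sequent (S : System) (F : Fragment) : Set where
  constructor _⟶_
  field
    antecedent : MetaFormula S F
    succedent  : Formula S F

-- Ξ( ) with a designated occurrence: either the whole meta-formula or the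
-- full content of one of its brackets.
data Context (S : System) (F : Fragment) : Set where
  hole   : Context S F
  inside : MetaFormula S F → Context S F → MetaFormula S F → Context S F

infix 6 _⟨_⟩

_⟨_⟩ : ∀ {S F} → Context S F → MetaFormula S F → MetaFormula S F
hole           ⟨ Θ ⟩ = Θ
inside Δ₁ Ξ Δ₂ ⟨ Θ ⟩ = Δ₁ ++ [ Ξ ⟨ Θ ⟩ ] ∷ Δ₂

bangs : ∀ {S F} → List (Formula S F) → MetaFormula S F
bangs = map (λ A → fm (! A))

NonEmptyIfRestricted : ∀ {S F} → MetaFormula S F → Set
NonEmptyIfRestricted {S} Γ = T (lambekRestricted S) → Γ ≢ []

data Derivable {S : System} {F : Fragment} : Sequent S F → Set where

  ax  : ∀ {A} → Derivable (fm A ∷ [] ⟶ A)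

  𝟏R  : ∀ {u : T (hasUnit S)} → Derivable ([] ⟶ 𝟏 {u = u})

  /L  : ∀ {Γ B C D Δ₁ Δ₂} Ξ →
        Derivable (Γ ⟶ B) →
        Derivable (Ξ ⟨ Δ₁ ++ fm C ∷ Δ₂ ⟩ ⟶ D) →
        Derivable (Ξ ⟨ Δ₁ ++ fm (C / B) ∷ Γ ++ Δ₂ ⟩ ⟶ D)

  /R  : ∀ {Γ B C} →
        NonEmptyIfRestricted Γ →
        Derivable (Γ ++ fm B ∷ [] ⟶ C) →
        Derivable (Γ ⟶ C / B)

  ∖L  : ∀ {Γ A C D Δ₁ Δ₂} Ξ →
        Derivable (Γ ⟶ A) →
        Derivable (Ξ ⟨ Δ₁ ++ fm C ∷ Δ₂ ⟩ ⟶ D) →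
        Derivable (Ξ ⟨ Δ₁ ++ Γ ++ fm (A ∖ C) ∷ Δ₂ ⟩ ⟶ D)

  ∖R  : ∀ {Γ A C} →
        NonEmptyIfRestricted Γ →
        Derivable (fm A ∷ Γ ⟶ C) →
        Derivable (Γ ⟶ A ∖ C)

  ·L  : ∀ {A B D Δ₁ Δ₂} Ξ →
        Derivable (Ξ ⟨ Δ₁ ++ fm A ∷ fm B ∷ Δ₂ ⟩ ⟶ D) →
        Derivable (Ξ ⟨ Δ₁ ++ fm (A · B) ∷ Δ₂ ⟩ ⟶ D)

  ·R  : ∀ {Γ Δ A B} →
        Derivable (Δ ⟶ A) →
        Derivable (Γ ⟶ B) →
        Derivable (Δ ++ Γ ⟶ A · B)

  𝟏L  : ∀ {u : T (hasUnit S)} {A Δ₁ Δ₂} Ξ →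
        Derivable (Ξ ⟨ Δ₁ ++ Δ₂ ⟩ ⟶ A) →
        Derivable (Ξ ⟨ Δ₁ ++ fm (𝟏 {u = u}) ∷ Δ₂ ⟩ ⟶ A)

  ∨L  : ∀ {a : T (hasAdditives F)} {A₁ A₂ C Δ₁ Δ₂} Ξ →
        Derivable (Ξ ⟨ Δ₁ ++ fm A₁ ∷ Δ₂ ⟩ ⟶ C) →
        Derivable (Ξ ⟨ Δ₁ ++ fm A₂ ∷ Δ₂ ⟩ ⟶ C) →
        Derivable (Ξ ⟨ Δ₁ ++ fm (_∨_ {a = a} A₁ A₂) ∷ Δ₂ ⟩ ⟶ C)

  ∨R₁ : ∀ {a : T (hasAdditives F)} {A₁ A₂ Ξ} →
        Derivable (Ξ ⟶ A₁) →
        Derivable (Ξ ⟶ _∨_ {a = a} A₁ A₂)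

  ∨R₂ : ∀ {a : T (hasAdditives F)} {A₁ A₂ Ξ} →
        Derivable (Ξ ⟶ A₂) →
        Derivable (Ξ ⟶ _∨_ {a = a} A₁ A₂)

  ∧L₁ : ∀ {a : T (hasAdditives F)} {A₁ A₂ C Δ₁ Δ₂} Ξ →
        Derivable (Ξ ⟨ Δ₁ ++ fm A₁ ∷ Δ₂ ⟩ ⟶ C) →
        Derivable (Ξ ⟨ Δ₁ ++ fm (_∧_ {a = a} A₁ A₂) ∷ Δ₂ ⟩ ⟶ C)

  ∧L₂ : ∀ {a : T (hasAdditives F)} {A₁ A₂ C Δ₁ Δ₂} Ξ →
        Derivable (Ξ ⟨ Δ₁ ++ fm A₂ ∷ Δ₂ ⟩ ⟶ C) →
        Derivable (Ξ ⟨ Δ₁ ++ fm (_∧_ {a = a} A₁ A₂) ∷ Δ₂ ⟩ ⟶ C)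

  ∧R  : ∀ {a : T (hasAdditives F)} {A₁ A₂ Ξ} →
        Derivable (Ξ ⟶ A₁) →
        Derivable (Ξ ⟶ A₂) →
        Derivable (Ξ ⟶ _∧_ {a = a} A₁ A₂)

  []⁻¹L : ∀ {A B Δ₁ Δ₂} Ξ →
        Derivable (Ξ ⟨ Δ₁ ++ fm A ∷ Δ₂ ⟩ ⟶ B) →
        Derivable (Ξ ⟨ Δ₁ ++ [ fm ([]⁻¹ A) ∷ [] ] ∷ Δ₂ ⟩ ⟶ B)

  []⁻¹R : ∀ {A Ξ} →
        Derivable ([ Ξ ] ∷ [] ⟶ A) →
        Derivable (Ξ ⟶ []⁻¹ A)

  ⟨⟩L : ∀ {A B Δ₁ Δ₂} Ξ →
        Derivable (Ξ ⟨ Δ₁ ++ [ fm A ∷ [] ] ∷ Δ₂ ⟩ ⟶ B) →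
        Derivable (Ξ ⟨ Δ₁ ++ fm (⟨⟩ A) ∷ Δ₂ ⟩ ⟶ B)

  ⟨⟩R : ∀ {A Ξ} →
        Derivable (Ξ ⟶ A) →
        Derivable ([ Ξ ] ∷ [] ⟶ ⟨⟩ A)

  !L  : ∀ {A C Δ₁ Δ₂} Ξ →
        Derivable (Ξ ⟨ Δ₁ ++ fm A ∷ Δ₂ ⟩ ⟶ C) →
        Derivable (Ξ ⟨ Δ₁ ++ fm (! A) ∷ Δ₂ ⟩ ⟶ C)

  !P₁ : ∀ {A C Φ Δ₁ Δ₂} Ξ →
        Derivable (Ξ ⟨ Δ₁ ++ fm (! A) ∷ Φ ++ Δ₂ ⟩ ⟶ C) →
        Derivable (Ξ ⟨ Δ₁ ++ Φ ++ fm (! A) ∷ Δ₂ ⟩ ⟶ C)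

  !P₂ : ∀ {A C Φ Δ₁ Δ₂} Ξ →
        Derivable (Ξ ⟨ Δ₁ ++ Φ ++ fm (! A) ∷ Δ₂ ⟩ ⟶ C) →
        Derivable (Ξ ⟨ Δ₁ ++ fm (! A) ∷ Φ ++ Δ₂ ⟩ ⟶ C)

  cut : ∀ {Π A C Γ₁ Γ₂} Ξ →
        Derivable (Π ⟶ A) →
        Derivable (Ξ ⟨ Γ₁ ++ fm A ∷ Γ₂ ⟩ ⟶ C) →
        Derivable (Ξ ⟨ Γ₁ ++ Π ++ Γ₂ ⟩ ⟶ C)

  -- In the 2015 rules the sequence A₁, …, Aₙ with n ≥ 1 is A ∷ As.
  !R₂₀₁₅ : ∀ {A As B} → T (rules2015 S) →
        Derivable (bangs (A ∷ As) ⟶ B) →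
        Derivable (bangs (A ∷ As) ⟶ ! B)

  !C₂₀₁₅ : ∀ {A As C Γ₁ Γ₂ Γ₃} Ξ → T (rules2015 S) →
        Derivable (Ξ ⟨ bangs (A ∷ As) ++ Γ₁ ++ [ bangs (A ∷ As) ++ Γ₂ ] ∷ Γ₃ ⟩ ⟶ C) →
        Derivable (Ξ ⟨ bangs (A ∷ As) ++ Γ₁ ++ Γ₂ ++ Γ₃ ⟩ ⟶ C)

  !R₂₀₁₈ : ∀ {A B} → T (rules2018 S) →
        Derivable (fm (! A) ∷ [] ⟶ B) →
        Derivable (fm (! A) ∷ [] ⟶ ! B)

  !C₂₀₁₈ : ∀ {A C Γ₁ Γ₂ Γ₃} Ξ → T (rules2018 S) →
        NonEmptyIfRestricted Γ₂ →
        Derivable (Ξ ⟨ fm (! A) ∷ Γ₁ ++ [ fm (! A) ∷ Γ₂ ] ∷ Γ₃ ⟩ ⟶ C) →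
        Derivable (Ξ ⟨ fm (! A) ∷ Γ₁ ++ [ [ Γ₂ ] ∷ [] ] ∷ Γ₃ ⟩ ⟶ C)

data Rec : ℕ → Set where
  zer  : Rec 0
  succ : Rec 1
  proj : ∀ {n} → Fin n → Rec n
  comp : ∀ {m n} → Rec m → Vec (Rec n) m → Rec n
  prec : ∀ {n} → Rec n → Rec (2 + n) → Rec (1 + n)
  min  : ∀ {n} → Rec (1 + n) → Rec n

infix 4 _⟪_⟫⇓_

data _⟪_⟫⇓_ : ∀ {n} → Rec n → Vec ℕ n → ℕ → Set where

  ⇓zer  : zer ⟪ [] ⟫⇓ 0

  ⇓succ : ∀ {x} → succ ⟪ x ∷ [] ⟫⇓ suc x

  ⇓proj : ∀ {n} {i : Fin n} {xs} → proj i ⟪ xs ⟫⇓ lookup xs i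

  ⇓comp : ∀ {m n} {f : Rec m} {gs : Vec (Rec n) m} {xs ys z} →
          Pointwise (λ g y → g ⟪ xs ⟫⇓ y) gs ys →
          f ⟪ ys ⟫⇓ z →
          comp f gs ⟪ xs ⟫⇓ z

  ⇓prec-zero : ∀ {n} {g : Rec n} {h xs z} →
          g ⟪ xs ⟫⇓ z →
          prec g h ⟪ 0 ∷ xs ⟫⇓ z

  ⇓prec-suc : ∀ {n} {g : Rec n} {h xs k y z} →
          prec g h ⟪ k ∷ xs ⟫⇓ y →
          h ⟪ k ∷ y ∷ xs ⟫⇓ z →
          prec g h ⟪ suc k ∷ xs ⟫⇓ z

  ⇓min  : ∀ {n} {f : Rec (1 + n)} {xs k} →
          (∀ i → i < k → ∃ λ y → f ⟪ i ∷ xs ⟫⇓ suc y) →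
          f ⟪ k ∷ xs ⟫⇓ 0 →
          min f ⟪ xs ⟫⇓ k

-- f computes the characteristic function of P along the coding.
-- Classically totality on codes follows; stating the two implications
-- instead of a disjunction makes the negation below constructively stronger.
Decides : {X : Set} → (X → ℕ) → (X → Set) → Rec 1 → Set
Decides code P f =
  ∀ x → (P x → f ⟪ code x ∷ [] ⟫⇓ 1) × (¬ P x → f ⟪ code x ∷ [] ⟫⇓ 0)

Undecidable : {X : Set} → (X → ℕ) → (X → Set) → Set
Undecidable code P = ¬ ∃ (Decides code P)

-- A bijection from ℕ × ℕ onto the positive integers; with 0 for the empty
-- sequence it makes all the codings below injective and effectively decodable.
pair : ℕ → ℕ → ℕ
pair x y = 2 ^ x * (2 * y + 1)

module _ {S : System} {F : Fragment} where

  codeFormula : Formula S F → ℕ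
  codeFormula (var n)  = pair 0 n
  codeFormula 𝟏        = pair 1 0
  codeFormula (A ∖ B)  = pair 2 (pair (codeFormula A) (codeFormula B))
  codeFormula (A / B)  = pair 3 (pair (codeFormula A) (codeFormula B))
  codeFormula (A · B)  = pair 4 (pair (codeFormula A) (codeFormula B))
  codeFormula (A ∧ B)  = pair 5 (pair (codeFormula A) (codeFormula B))
  codeFormula (A ∨ B)  = pair 6 (pair (codeFormula A) (codeFormula B))
  codeFormula (⟨⟩ A)   = pair 7 (codeFormula A)
  codeFormula ([]⁻¹ A) = pair 8 (codeFormula A)
  codeFormula (! A)    = pair 9 (codeFormula A)

  codeTreeTerm    : TreeTerm S F → ℕ
  codeMetaFormula : MetaFormula S F → ℕ

  codeTreeTerm (fm A) = pair 0 (codeFormula A)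
  codeTreeTerm [ Ξ ]  = pair 1 (codeMetaFormula Ξ)

  codeMetaFormula []      = 0
  codeMetaFormula (t ∷ Ξ) = pair (codeTreeTerm t) (codeMetaFormula Ξ)

  codeSequent : Sequent S F → ℕ
  codeSequent (Ξ ⟶ C) = pair (codeFormula C) (codeMetaFormula Ξ)

DerivabilityUndecidable : System → Fragment → Set
DerivabilityUndecidable S F =
  Undecidable (codeSequent {S} {F}) (Derivable {S} {F})

{-# OPTIONS --safe #-}
module Submission where

-- A decider f for derivability yields a register program which, started with n
-- in register 0, halts iff f answers 0 on the sequent saying that this very
-- program halts on n; the diagonal n is the code of the part of the antecedent
-- that describes the program.
--
-- Programs are executed by rewriting words of variables: a rule l ⇝ r becomes
-- the formula B = ⊗l ∖ ⊗r, made reusable as !([]⁻¹(!B · T) / t).  Contraction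
-- places a copy of it in a bracket next to t, where it leaves !B, which moves
-- freely, and restores the token T.  The 2018 contraction consumes a double
-- bracket, so there T = ⟨⟩⟨⟩t; in the 2015 system T = t.
--
-- Conversely, all rules, including cut, are sound for binary relations with
-- trivial brackets, where !A is the identity if A contains it and empty
-- otherwise.  In the relational model on sets of machine states a derivation
-- forces the program to halt.  Since f always answers, it is enough to
-- simulate its terminating evaluations and to know that programs are
-- deterministic.

open import Data.Empty using (⊥-elim)
open import Data.Fin using (zero; suc)
open import Data.List using (List; []; _∷_; _++_; map; filter; replicate)
open import Data.List.Membership.Propositional using (_∈_)
open import Data.List.Membership.Propositional.Properties
  using (∈-map⁺; ∈-filter⁺; ∈-++⁺ˡ; ∈-++⁺ʳ; ∈-++⁻; ∈-∃++)
open import Data.List.NonEmpty using (List⁺; _∷_; toList)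
open import Data.List.Properties using (++-assoc; map-++; ∷ʳ-++)
open import Data.List.Relation.Binary.Subset.Propositional using (_⊆_)
open import Data.List.Relation.Unary.All as All using (All; []; _∷_)
import Data.List.Relation.Unary.All.Properties as All
open import Data.List.Relation.Unary.Any using (here; there)
open import Data.Nat using (ℕ; zero; suc; _+_; _*_; _^_; _≤_; _<_; z≤n; s≤s; _≟_)
open import Data.Nat.Properties
open import Data.Nat.Tactic.RingSolver using (solve-∀)
open import Data.Product using (∃; _×_; _,_; proj₁; proj₂)
open import Data.Sum using (inj₁; inj₂; [_,_]′)
open import Data.Unit using (⊤; tt)
open import Data.Vec using (Vec; []; _∷_; lookup)
open import Data.Vec.Relation.Binary.Pointwise.Inductive as Pointwise
  using (Pointwise; []; _∷_)
open import Function using (_∘_)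
open import Level using (Lift; lift; lower; 0ℓ) renaming (suc to lsuc)
open import Relation.Binary.PropositionalEquality
open import Relation.Nullary using (¬_; ¬?; yes; no)
open import Defs

-- Relational semantics

module Relational {a} {X : Set a} (V : ℕ → X → X → Set a) {S : System} where

  ⟦_⟧ : Formula S mult → X → X → Set a
  ⟦ var i ⟧  x y = V i x y
  ⟦ 𝟏 ⟧      x y = x ≡ y
  ⟦ A ∖ B ⟧  x y = ∀ z → ⟦ A ⟧ z x → ⟦ B ⟧ z y
  ⟦ B / A ⟧  x y = ∀ z → ⟦ A ⟧ y z → ⟦ B ⟧ x z
  ⟦ A · B ⟧  x y = ∃ λ z → ⟦ A ⟧ x z × ⟦ B ⟧ z y
  ⟦ _∧_ {()} _ _ ⟧
  ⟦ _∨_ {()} _ _ ⟧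
  ⟦ ⟨⟩ A ⟧   x y = ⟦ A ⟧ x y
  ⟦ []⁻¹ A ⟧ x y = ⟦ A ⟧ x y
  ⟦ ! A ⟧    x y = x ≡ y × (∀ z → ⟦ A ⟧ z z)

  data Term  : TreeTerm S mult → X → X → Set a
  data Chain : MetaFormula S mult → X → X → Set a

  data Term where
    fm  : ∀ {A x y} → ⟦ A ⟧ x y → Term (fm A) x y
    [_] : ∀ {Γ x y} → Chain Γ x y → Term [ Γ ] x y

  data Chain where
    []  : ∀ {x} → Chain [] x x
    _∷_ : ∀ {t Γ x y z} → Term t x y → Chain Γ y z → Chain (t ∷ Γ) x z

  infix 4 _⊑_

  _⊑_ : MetaFormula S mult → MetaFormula S mult → Set a
  Γ ⊑ Δ = ∀ {x y} → Chain Γ x y → Chain Δ x y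

  append : ∀ {Γ Δ x y z} → Chain Γ x y → Chain Δ y z → Chain (Γ ++ Δ) x z
  append []      q = q
  append (t ∷ p) q = t ∷ append p q

  split : ∀ Γ {Δ x z} → Chain (Γ ++ Δ) x z → ∃ λ y → Chain Γ x y × Chain Δ y z
  split []      q       = _ , [] , q
  split (t ∷ Γ) (p ∷ q) with split Γ q
  ... | y , r , s = y , p ∷ r , s

  prefix-mono : ∀ Δ {Γ Γ′} → Γ ⊑ Γ′ → Δ ++ Γ ⊑ Δ ++ Γ′
  prefix-mono []      h p       = h p
  prefix-mono (t ∷ Δ) h (p ∷ q) = p ∷ prefix-mono Δ h q

  context-mono : ∀ Ξ {Γ Γ′} → Γ ⊑ Γ′ → Ξ ⟨ Γ ⟩ ⊑ Ξ ⟨ Γ′ ⟩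
  context-mono hole             h = h
  context-mono (inside Δ₁ Ξ Δ₂) h =
    prefix-mono Δ₁ λ { ([ p ] ∷ q) → [ context-mono Ξ h p ] ∷ q }

  within : ∀ Ξ Δ {Γ Γ′} → Γ ⊑ Γ′ → Ξ ⟨ Δ ++ Γ ⟩ ⊑ Ξ ⟨ Δ ++ Γ′ ⟩
  within Ξ Δ h = context-mono Ξ (prefix-mono Δ h)

  -- What a chain of `!` formulae asserts does not depend on the point, so it can be repeated
  -- anywhere. The 2015 promotion and contraction rest on this.
  bangs-central : ∀ As {x y} → Chain (bangs As) x y →
                  x ≡ y × (∀ z → Chain (bangs As) z z)
  bangs-central []       []                = refl , λ _ → []
  bangs-central (A ∷ As) (fm (refl , h) ∷ p) with bangs-central As p
  ... | e , k = e , λ z → fm (refl , h) ∷ k z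

  -- A left rule is sound when the hole of its conclusion is included in that of its main premise.
  -- Cut is of the same kind, so it is interpreted directly and not eliminated.
  sound : ∀ {Γ C} → Derivable (Γ ⟶ C) → ∀ {x y} → Chain Γ x y → ⟦ C ⟧ x y
  sound ax (fm p ∷ []) = p
  sound 𝟏R [] = refl
  sound (/L {Γ = Γ} {Δ₁ = Δ₁} Ξ d e) p = sound e (within Ξ Δ₁ (λ
    { (fm f ∷ q) → let w , g , r = split Γ q in fm (f w (sound d g)) ∷ r }) p)
  sound (/R _ d) p z q = sound d (append p (fm q ∷ []))
  sound (∖L {Γ = Γ} {A} {C} {D} {Δ₁} {Δ₂} Ξ d e) p = sound e (within Ξ Δ₁ apply p)
    where
    apply : Γ ++ fm (A ∖ C) ∷ Δ₂ ⊑ fm C ∷ Δ₂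
    apply q with split Γ q
    ... | _ , g , fm f ∷ r = fm (f _ (sound d g)) ∷ r
  sound (∖R _ d) p z q = sound d (fm q ∷ p)
  sound (·L {Δ₁ = Δ₁} Ξ d) p =
    sound d (within Ξ Δ₁ (λ { (fm (_ , q , r) ∷ s) → fm q ∷ fm r ∷ s }) p)
  sound (·R {Δ = Δ} d e) p =
    let z , q , r = split Δ p in z , sound d q , sound e r
  sound (𝟏L {Δ₁ = Δ₁} Ξ d) p = sound d (within Ξ Δ₁ (λ { (fm refl ∷ q) → q }) p)
  sound (∨L {()} _ _ _)
  sound (∨R₁ {()} _)
  sound (∨R₂ {()} _)
  sound (∧L₁ {()} _ _)
  sound (∧L₂ {()} _ _)
  sound (∧R {()} _ _)
  sound ([]⁻¹L {Δ₁ = Δ₁} Ξ d) p =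
    sound d (within Ξ Δ₁ (λ { ([ fm q ∷ [] ] ∷ r) → fm q ∷ r }) p)
  sound ([]⁻¹R d) p = sound d ([ p ] ∷ [])
  sound (⟨⟩L {Δ₁ = Δ₁} Ξ d) p =
    sound d (within Ξ Δ₁ (λ { (fm q ∷ r) → [ fm q ∷ [] ] ∷ r }) p)
  sound (⟨⟩R d) ([ p ] ∷ []) = sound d p
  sound (!L {Δ₁ = Δ₁} Ξ d) p =
    sound d (within Ξ Δ₁ (λ { (fm (refl , h) ∷ q) → fm (h _) ∷ q }) p)
  sound (!P₁ {A} {C} {Φ} {Δ₁} {Δ₂} Ξ d) p = sound d (within Ξ Δ₁ permute p)
    where
    permute : Φ ++ fm (! A) ∷ Δ₂ ⊑ fm (! A) ∷ Φ ++ Δ₂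
    permute q with split Φ q
    ... | _ , r , fm (refl , h) ∷ s = fm (refl , h) ∷ append r s
  sound (!P₂ {A} {C} {Φ} {Δ₁} {Δ₂} Ξ d) p = sound d (within Ξ Δ₁ permute p)
    where
    permute : fm (! A) ∷ Φ ++ Δ₂ ⊑ Φ ++ fm (! A) ∷ Δ₂
    permute (fm (refl , h) ∷ q) with split Φ q
    ... | _ , r , s = append r (fm (refl , h) ∷ s)
  sound (cut {Π = Π} {Γ₁ = Γ₁} Ξ d e) p = sound e (within Ξ Γ₁ (λ q →
    let w , r , s = split Π q in fm (sound d r) ∷ s) p)
  sound (!R₂₀₁₅ {A} {As} _ d) p =
    let e , h = bangs-central (A ∷ As) p in e , λ z → sound d (h z)
  sound (!C₂₀₁₅ {A} {As} {Γ₁ = Γ₁} {Γ₂} Ξ _ d) p =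
    sound d (context-mono Ξ (λ q →
      let _ , b , r = split (bangs (A ∷ As)) q
          _ , g , s = split Γ₁ r
          _ , h , t = split Γ₂ s
          -- The second copy of the `!` formulae is made at the point where the new bracket opens.
          _ , b′    = bangs-central (A ∷ As) b
      in append b (append g ([ append (b′ _) h ] ∷ t))) p)
  sound (!R₂₀₁₈ _ d) (fm (refl , h) ∷ []) =
    refl , λ z → sound d (fm (refl , h) ∷ [])
  sound (!C₂₀₁₈ {Γ₁ = Γ₁} Ξ _ _ d) p = sound d (context-mono Ξ (λ
    { (fm (e , h) ∷ q) → fm (e , h) ∷ prefix-mono Γ₁
        (λ { ([ [ r ] ∷ [] ] ∷ s) → [ fm (refl , h) ∷ r ] ∷ s }) q }) p)

-- Register programs

+-swap : ∀ x y z → x + (y + z) ≡ y + (x + z)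
+-swap = solve-∀

State : Set
State = ℕ → ℕ

-- The Kronecker delta: `δ r` is the unit vector of register `r`.
δ : ℕ → State
δ zero    zero    = 1
δ zero    (suc _) = 0
δ (suc _) zero    = 0
δ (suc r) (suc s) = δ r s

δ-diag : ∀ r → δ r r ≡ 1
δ-diag zero    = refl
δ-diag (suc r) = δ-diag r

δ-≢ : ∀ {r s} → r ≢ s → δ r s ≡ 0
δ-≢ {zero}  {zero}  r≢s = ⊥-elim (r≢s refl)
δ-≢ {zero}  {suc _} _   = refl
δ-≢ {suc _} {zero}  _   = refl
δ-≢ {suc r} {suc s} r≢s = δ-≢ (r≢s ∘ cong suc)

-- mark 0 has no effect; mark (suc r) increments register r, because
-- δ 0 (suc s) = 0 and δ (suc r) (suc s) = δ r s.
data Cmd : Set where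
  mark dec test : ℕ → Cmd
  _⨾_           : Cmd → Cmd → Cmd
  loop          : ℕ → Cmd → Cmd

infixr 4 _⨾_

-- Pointwise equations replace equality of states, which avoids function extensionality. The
-- equation for `dec` also forces register `r` to be positive.
data Run : Cmd → State → State → Set where
  mark : ∀ {m σ τ} → (∀ s → τ s ≡ δ m (suc s) + σ s) → Run (mark m) σ τ
  dec  : ∀ {r σ τ} → (∀ s → σ s ≡ δ r s + τ s) → Run (dec r) σ τ
  test : ∀ {r σ τ} → σ r ≡ 0 → (∀ s → τ s ≡ σ s) → Run (test r) σ τ
  _⨾_  : ∀ {c d ρ σ τ} → Run c ρ σ → Run d σ τ → Run (c ⨾ d) ρ τ
  stop : ∀ {r c σ τ} → Run (test r) σ τ → Run (loop r c) σ τ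
  step : ∀ {r c π ρ σ τ} → Run (dec r) π ρ → Run c ρ σ → Run (loop r c) σ τ →
         Run (loop r c) π τ

Run-resp : ∀ {c σ σ′ τ τ′} → σ ≗ σ′ → τ ≗ τ′ → Run c σ τ → Run c σ′ τ′
Run-resp p q (mark {m} h)  =
  mark λ s → trans (sym (q s)) (trans (h s) (cong (δ m (suc s) +_) (p s)))
Run-resp p q (dec {r} h)   =
  dec λ s → trans (sym (p s)) (trans (h s) (cong (δ r s +_) (q s)))
Run-resp p q (test z h)    =
  test (trans (sym (p _)) z) λ s → trans (sym (q s)) (trans (h s) (p s))
Run-resp p q (x ⨾ y)       = Run-resp p (λ _ → refl) x ⨾ Run-resp (λ _ → refl) q y
Run-resp p q (stop x)      = stop (Run-resp p q x)
Run-resp p q (step x y z)  =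
  step (Run-resp p (λ _ → refl) x) y (Run-resp (λ _ → refl) q z)

dec-positive : ∀ {r σ τ} → Run (dec r) σ τ → σ r ≢ 0
dec-positive {r} {τ = τ} (dec h) z with trans (sym z) (trans (h r) (cong (_+ τ r) (δ-diag r)))
... | ()

-- `stop` requires a zero register and `step` a positive one, so at most one of them applies to a
-- loop.
Run-deterministic : ∀ {c σ σ′ τ τ′} → Run c σ τ → Run c σ′ τ′ → σ ≗ σ′ → τ ≗ τ′
Run-deterministic (mark {m} h) (mark h′) e s =
  trans (h s) (trans (cong (δ m (suc s) +_) (e s)) (sym (h′ s)))
Run-deterministic (dec {r} h) (dec h′) e s =
  +-cancelˡ-≡ (δ r s) _ _ (trans (sym (h s)) (trans (e s) (h′ s)))
Run-deterministic (test _ h) (test _ h′) e s =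
  trans (h s) (trans (e s) (sym (h′ s)))
Run-deterministic (x ⨾ y) (x′ ⨾ y′) e =
  Run-deterministic y y′ (Run-deterministic x x′ e)
Run-deterministic (stop x) (stop x′) e = Run-deterministic x x′ e
Run-deterministic (stop (test z _)) (step x′ _ _) e =
  ⊥-elim (dec-positive x′ (trans (sym (e _)) z))
Run-deterministic (step x _ _) (stop (test z _)) e =
  ⊥-elim (dec-positive x (trans (e _) z))
Run-deterministic (step x y z) (step x′ y′ z′) e =
  Run-deterministic z z′ (Run-deterministic y y′ (Run-deterministic x x′ e))

-- Clearing, moving and copying registers

inc : ℕ → Cmd
inc r = mark (suc r)

clear : ℕ → Cmd
clear a = loop a (mark 0)

move : ℕ → ℕ → Cmd
move a b = loop a (inc b)

copy : ℕ → ℕ → ℕ → Cmd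
copy a b t = move a t ⨾ loop t (inc a ⨾ inc b)

infixr 5 _↦_⊕_

-- Opaque, so that r, v and σ can be inferred from r ↦ v ⊕ σ.
opaque

  _↦_⊕_ : ℕ → ℕ → State → State
  (r ↦ v ⊕ σ) s = v * δ r s + σ s

  ⊕-apply : ∀ r v σ s → (r ↦ v ⊕ σ) s ≡ v * δ r s + σ s
  ⊕-apply r v σ s = refl

  ⊕-zero : ∀ r σ → (r ↦ 0 ⊕ σ) ≗ σ
  ⊕-zero r σ s = refl

  ⊕-suc : ∀ r v σ s → (r ↦ suc v ⊕ σ) s ≡ δ r s + (r ↦ v ⊕ σ) s
  ⊕-suc r v σ s = +-assoc (δ r s) _ _

  ⊕-cong : ∀ r {v w σ τ} → v ≡ w → σ ≗ τ → (r ↦ v ⊕ σ) ≗ (r ↦ w ⊕ τ)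
  ⊕-cong r {v} refl e s = cong (v * δ r s +_) (e s)

  ⊕-same : ∀ r v σ → (r ↦ v ⊕ σ) r ≡ v + σ r
  ⊕-same r v σ = cong (_+ σ r) (trans (cong (v *_) (δ-diag r)) (*-identityʳ v))

  ⊕-other : ∀ {r s v σ} → r ≢ s → (r ↦ v ⊕ σ) s ≡ σ s
  ⊕-other {r} {s} {v} {σ} r≢s =
    cong (_+ σ s) (trans (cong (v *_) (δ-≢ r≢s)) (*-zeroʳ v))

  ⊕-swap : ∀ p v q w σ → (p ↦ v ⊕ q ↦ w ⊕ σ) ≗ (q ↦ w ⊕ p ↦ v ⊕ σ)
  ⊕-swap p v q w σ s = +-swap (v * δ p s) (w * δ q s) (σ s)

  ⊕-rotate : ∀ p u q v r w σ → (p ↦ u ⊕ q ↦ v ⊕ r ↦ w ⊕ σ) ≗ (r ↦ w ⊕ p ↦ u ⊕ q ↦ v ⊕ σ)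
  ⊕-rotate p u q v r w σ s = rotate (u * δ p s) (v * δ q s) (w * δ r s) (σ s)
    where
    rotate : ∀ x y z t → x + (y + (z + t)) ≡ z + (x + (y + t))
    rotate = solve-∀

⊕-fresh : ∀ {r v σ} → σ r ≡ 0 → (r ↦ v ⊕ σ) r ≡ v
⊕-fresh {r} {v} {σ} z = trans (⊕-same r v σ) (trans (cong (v +_) z) (+-identityʳ v))

Run-inc : ∀ {r v σ} → Run (inc r) (r ↦ v ⊕ σ) (r ↦ suc v ⊕ σ)
Run-inc {r} {v} {σ} = mark (⊕-suc r v σ)

Run-dec : ∀ {r v σ} → Run (dec r) (r ↦ suc v ⊕ σ) (r ↦ v ⊕ σ)
Run-dec {r} {v} {σ} = dec (⊕-suc r v σ)

-- Induction on `v`, with `ε` moved into `σ` at each pass. The vector is 0 in `clear`, `δ b` in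
-- `move` and `δ b + δ a` in the second loop of `copy`.
drain : ∀ {a c} {ε : State} → ε a ≡ 0 →
        (∀ σ → Run c σ (λ s → ε s + σ s)) →
        ∀ v {σ τ} → σ a ≡ 0 → (∀ s → τ s ≡ v * ε s + σ s) →
        Run (loop a c) (a ↦ v ⊕ σ) τ
drain {a} ε≡0 body zero {σ} σ≡0 h =
  stop (test (trans (⊕-zero a σ a) σ≡0) λ s → trans (h s) (sym (⊕-zero a σ s)))
drain {a} {ε = ε} ε≡0 body (suc v) {σ} σ≡0 h =
  step Run-dec (body _)
    (Run-resp slide (λ _ → refl)
      (drain {a} ε≡0 body v {λ s → ε s + σ s} (cong₂ _+_ ε≡0 σ≡0)
        λ s → trans (h s) (shift v (ε s) (σ s))))
  where
  shift : ∀ v x y → suc v * x + y ≡ v * x + (x + y)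
  shift = solve-∀
  slide : (a ↦ v ⊕ (λ s → ε s + σ s)) ≗ (λ s → ε s + (a ↦ v ⊕ σ) s)
  slide s = trans (⊕-apply a v _ s)
    (trans (+-swap (v * δ a s) (ε s) (σ s)) (cong (ε s +_) (sym (⊕-apply a v σ s))))

Run-clear : ∀ {a v σ} → σ a ≡ 0 → Run (clear a) (a ↦ v ⊕ σ) σ
Run-clear {v = v} {σ} z = drain {ε = λ _ → 0} refl (λ _ → mark λ _ → refl) v z
  λ s → sym (cong (_+ σ s) (*-zeroʳ v))

Run-move : ∀ {a b v σ} → b ≢ a → σ a ≡ 0 → Run (move a b) (a ↦ v ⊕ σ) (b ↦ v ⊕ σ)
Run-move {b = b} {v} {σ} b≢a z =
  drain (δ-≢ b≢a) (λ _ → mark λ _ → refl) v z (⊕-apply b v σ)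

-- Splits register `a` off an arbitrary state, as `σ a * δ a + wipe a σ`, so that the lemma on
-- `move` applies to it.
wipe : ℕ → State → State
wipe zero    σ zero    = 0
wipe zero    σ (suc s) = σ (suc s)
wipe (suc a) σ zero    = σ zero
wipe (suc a) σ (suc s) = wipe a (σ ∘ suc) s

wipe-same : ∀ a σ → wipe a σ a ≡ 0
wipe-same zero    σ = refl
wipe-same (suc a) σ = wipe-same a (σ ∘ suc)

wipe-≡0 : ∀ a σ s → σ s ≡ 0 → wipe a σ s ≡ 0
wipe-≡0 zero    σ zero    z = refl
wipe-≡0 zero    σ (suc s) z = z
wipe-≡0 (suc a) σ zero    z = z
wipe-≡0 (suc a) σ (suc s) z = wipe-≡0 a (σ ∘ suc) s z

wipe-restore : ∀ a σ s → σ a * δ a s + wipe a σ s ≡ σ s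
wipe-restore zero    σ zero    = trans (+-identityʳ _) (*-identityʳ _)
wipe-restore zero    σ (suc s) = cong (_+ σ (suc s)) (*-zeroʳ (σ zero))
wipe-restore (suc a) σ zero    = cong (_+ σ zero) (*-zeroʳ (σ (suc a)))
wipe-restore (suc a) σ (suc s) = wipe-restore a (σ ∘ suc) s

Run-copy : ∀ {a b t σ} → a ≢ t → b ≢ t → σ t ≡ 0 → Run (copy a b t) σ (b ↦ σ a ⊕ σ)
Run-copy {a} {b} {t} {σ} a≢t b≢t z =
  Run-resp (λ s → trans (⊕-apply a (σ a) (wipe a σ) s) (wipe-restore a σ s)) (λ _ → refl)
    (Run-move (a≢t ∘ sym) (wipe-same a σ)) ⨾
  drain {ε = λ s → δ b s + δ a s} (cong₂ _+_ (δ-≢ b≢t) (δ-≢ a≢t))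
    (λ σ′ → mark (λ _ → refl) ⨾ mark λ s → +-assoc (δ b s) (δ a s) (σ′ s))
    (σ a) (wipe-≡0 a σ t z)
    λ s → trans (⊕-apply b (σ a) σ s)
      (trans (cong (σ a * δ b s +_) (sym (wipe-restore a σ s)))
             (distrib (σ a) (δ b s) (δ a s) (wipe a σ s)))
  where
  distrib : ∀ v x y z → v * x + (v * y + z) ≡ v * (x + y) + z
  distrib = solve-∀

-- Compilation of recursive functions

Clean : ℕ → State → Set
Clean o σ = ∀ {s} → o ≤ s → σ s ≡ 0

Clean-⊕ : ∀ {o r v σ} → o ≤ r → Clean o σ → Clean (suc r) (r ↦ v ⊕ σ)
Clean-⊕ o≤r z r<s = trans (⊕-other (<⇒≢ r<s)) (z (≤-trans o≤r (<⇒≤ r<s)))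

Holds : ∀ {n} → State → ℕ → Vec ℕ n → Vec ℕ n → Set
Holds σ o = Pointwise λ r x → r < o × σ r ≡ x

Holds-≤ : ∀ {n σ o p} {ρ xs : Vec ℕ n} → o ≤ p → Holds σ o ρ xs → Holds σ p ρ xs
Holds-≤ o≤p = Pointwise.map λ (r<o , e) → <-≤-trans r<o o≤p , e

Holds-⊕ : ∀ {n σ o p v} {ρ xs : Vec ℕ n} → o ≤ p → Holds σ o ρ xs →
          Holds (p ↦ v ⊕ σ) o ρ xs
Holds-⊕ o≤p = Pointwise.map λ (r<o , e) →
  r<o , trans (⊕-other (<⇒≢ (<-≤-trans r<o o≤p) ∘ sym)) e

range : ℕ → (n : ℕ) → Vec ℕ n
range p zero    = []
range p (suc n) = p ∷ range (suc p) n

-- compile g ρ o adds the value of g at the registers ρ to register o,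
-- using the registers from o on as scratch space.
compile     : ∀ {n} → Rec n → Vec ℕ n → ℕ → Cmd
compileArgs : ∀ {m n} → Vec (Rec n) m → Vec ℕ n → ℕ → Cmd → Cmd

compile zer          ρ       o = mark 0
compile succ         (r ∷ _) o = copy r o (1 + o) ⨾ inc o
compile (proj i)     ρ       o = copy (lookup ρ i) o (1 + o)
compile (comp {m} f gs) ρ    o =
  compileArgs gs ρ (1 + o) (compile f (range (1 + o) m) (m + (1 + o)) ⨾ move (m + (1 + o)) o)
compile (prec g h)   (r ∷ ρ) o =
  compile g ρ o ⨾ copy r (2 + o) (3 + o) ⨾
  loop (2 + o) (compile h (1 + o ∷ o ∷ ρ) (3 + o) ⨾ clear o ⨾ move (3 + o) o ⨾ inc (1 + o)) ⨾
  clear (1 + o)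
compile (min f)      ρ       o =
  compile f (o ∷ ρ) (1 + o) ⨾
  loop (1 + o) (clear (1 + o) ⨾ inc o ⨾ compile f (o ∷ ρ) (1 + o))

compileArgs []       ρ p c = c
compileArgs (g ∷ gs) ρ p c = compile g ρ p ⨾ compileArgs gs ρ (1 + p) c ⨾ clear p

via : ∀ {c d ρ σ σ′ τ} → Run c ρ σ → σ ≗ σ′ → Run d σ′ τ → Run (c ⨾ d) ρ τ
via x e y = x ⨾ Run-resp (sym ∘ e) (λ _ → refl) y

above : ∀ k {o} → o ≢ suc k + o
above k {o} = m≢1+n+m o {k}

run-compile : ∀ {n} (g : Rec n) {ρ xs y o σ} → g ⟪ xs ⟫⇓ y →
              Holds σ o ρ xs → Clean o σ → Run (compile g ρ o) σ (o ↦ y ⊕ σ)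

-- The command `c` runs while the arguments are stored from `p` on; they are cleared after it, the
-- last one first. `q` is given by an equation because it stays fixed while `m` and `p` vary in the
-- induction.
run-args : ∀ {m n} (gs : Vec (Rec n) m) {ρ xs ys o p q z c σ} →
           Pointwise (λ g y → g ⟪ xs ⟫⇓ y) gs ys →
           o < p → q ≡ m + p → Holds σ p ρ xs → Clean p σ →
           (∀ {τ} → (∀ {s} → s < p → τ s ≡ σ s) → Holds τ q (range p m) ys →
            Clean q τ → Run c τ (o ↦ z ⊕ τ)) →
           Run (compileArgs gs ρ p c) σ (o ↦ z ⊕ σ)

run-compile zer {o = o} {σ} ⇓zer holds clean = mark (⊕-zero o σ)
run-compile succ {o = o} ⇓succ ((r<o , refl) ∷ []) clean =
  Run-copy (<⇒≢ (m<n⇒m<1+n r<o)) (above 0) (clean (n≤1+n o)) ⨾ Run-inc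
run-compile (proj i) {o = o} ⇓proj holds clean with Pointwise.lookup holds i
... | r<o , e = Run-resp (λ _ → refl) (⊕-cong o e λ _ → refl)
  (Run-copy (<⇒≢ (m<n⇒m<1+n r<o)) (above 0) (clean (n≤1+n o)))
run-compile (comp {m} f gs) {o = o} (⇓comp evals eval) holds clean =
  run-args gs evals (n<1+n o) refl (Holds-≤ (n≤1+n o) holds)
    (λ o<s → clean (<⇒≤ o<s))
    λ _ holds′ clean′ → run-compile f eval holds′ clean′ ⨾
      Run-move (<⇒≢ (m≤n+m (1 + o) m)) (clean′ ≤-refl)
run-compile (prec g h) {r ∷ ρ} {k ∷ xs} {y} {o} {σ} eval ((r<o , e) ∷ holds) clean =
  let y₀ , init , iterate = prec-loop k eval in
  init ⨾
  via (Run-copy (<⇒≢ (≤-trans r<o (m≤n+m o 3))) (above 0)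
        (Clean-⊕ ≤-refl clean (m≤n+m (1 + o) 2)))
      (⊕-cong (2 + o) (trans (⊕-other (<⇒≢ r<o ∘ sym)) (trans e (sym (+-identityʳ k))))
        (⊕-cong o refl (sym ∘ ⊕-zero (1 + o) σ)))
  (iterate 0 (stop (test (trans (⊕-zero (2 + o) _ (2 + o)) at-counter) λ _ → refl)) ⨾
  Run-resp (λ s → trans (⊕-swap (1 + o) k o y σ s) (sym (⊕-zero (2 + o) _ s))) (λ _ → refl)
    (Run-clear (trans (⊕-other (above 0)) (clean (n≤1+n o)))))
  where
  -- `m` rounds remain, `y` is the value so far and `k` the current index; `h` leaves its result in
  -- register `3 + o`.
  state : ℕ → ℕ → ℕ → State
  state m y k = 2 + o ↦ m ⊕ o ↦ y ⊕ 1 + o ↦ k ⊕ σ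

  body : Cmd
  body = compile h (1 + o ∷ o ∷ ρ) (3 + o) ⨾ clear o ⨾ move (3 + o) o ⨾ inc (1 + o)

  at-counter : ∀ {y k} → (o ↦ y ⊕ 1 + o ↦ k ⊕ σ) (2 + o) ≡ 0
  at-counter = trans (⊕-other (above 1)) (Clean-⊕ (n≤1+n o) clean ≤-refl)

  run-body : ∀ {m y k z} → h ⟪ k ∷ y ∷ xs ⟫⇓ z →
             Run body (state m y k) (state m z (suc k))
  run-body {m} {y} {k} {z} eval =
    via (run-compile h eval
          ((m≤n+m (2 + o) 1 , at-index) ∷ (m≤n+m (1 + o) 2 , at-acc) ∷
           Holds-≤ (m≤n+m o 3) (Holds-⊕ (m≤n+m o 2) (Holds-⊕ ≤-refl (Holds-⊕ (n≤1+n o) holds))))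
          (Clean-⊕ ≤-refl λ le → trans (⊕-other (<⇒≢ (<⇒≤ le))) (Clean-⊕ (n≤1+n o) clean le)))
        (⊕-rotate (3 + o) z (2 + o) m o y _)
    (Run-clear (trans (⊕-other (above 2 ∘ sym)) (trans (⊕-other (above 1 ∘ sym))
      (trans (⊕-other (above 0 ∘ sym)) (clean ≤-refl)))) ⨾
    Run-move (above 2) (trans (⊕-other (above 0)) (Clean-⊕ (n≤1+n o) clean (n≤1+n (2 + o)))) ⨾
    Run-resp (λ s → sym (⊕-rotate o z (2 + o) m (1 + o) k σ s))
             (λ s → trans (sym (⊕-rotate o z (2 + o) m (1 + o) (suc k) σ s))
                          (⊕-swap o z (2 + o) m _ s))
      Run-inc)
    where
    at-index : state m y k (1 + o) ≡ k
    at-index = trans (⊕-other (above 0 ∘ sym))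
      (trans (⊕-other (above 0)) (⊕-fresh (clean (n≤1+n o))))
    at-acc : state m y k o ≡ y
    at-acc = trans (⊕-other (above 1 ∘ sym))
      (⊕-fresh (trans (⊕-other (above 0 ∘ sym)) (clean ≤-refl)))

  -- The evaluation ends with the last round but the loop starts with the first, so rounds are
  -- prepended to a given run of the rest of the loop.
  prec-loop : ∀ k {y} → prec g h ⟪ k ∷ xs ⟫⇓ y →
              ∃ λ y₀ → Run (compile g ρ o) σ (o ↦ y₀ ⊕ σ) ×
              (∀ m {τ} → Run (loop (2 + o) body) (state m y k) τ →
                         Run (loop (2 + o) body) (state (k + m) y₀ 0) τ)
  prec-loop zero    (⇓prec-zero eval) =
    _ , run-compile g eval holds clean , λ _ x → x
  prec-loop (suc k) (⇓prec-suc eval₁ eval₂) with prec-loop k eval₁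
  ... | y₀ , x , f = y₀ , x , λ m {τ} z → subst
    (λ j → Run (loop (2 + o) body) (state j y₀ 0) τ) (+-suc k m)
    (f (suc m) (step Run-dec (run-body eval₂) z))
run-compile (min f) {ρ} {xs} {k} {o} {σ} (⇓min below eval) holds clean =
  Run-resp (⊕-zero o σ) (λ _ → refl) (search k 0 (+-identityʳ k))
  where
  body : Cmd
  body = clear (1 + o) ⨾ inc o ⨾ compile f (o ∷ ρ) (1 + o)

  run-f : ∀ {j y} → f ⟪ j ∷ xs ⟫⇓ y →
          Run (compile f (o ∷ ρ) (1 + o)) (o ↦ j ⊕ σ) (1 + o ↦ y ⊕ o ↦ j ⊕ σ)
  run-f eval = run-compile f eval
    ((≤-refl , ⊕-fresh (clean ≤-refl)) ∷ Holds-≤ (n≤1+n o) (Holds-⊕ ≤-refl holds))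
    (Clean-⊕ ≤-refl clean)

  at-flag : ∀ {j} → (o ↦ j ⊕ σ) (1 + o) ≡ 0
  at-flag = Clean-⊕ ≤-refl clean ≤-refl

  -- Stated for an evaluation of `f` followed by the loop, so that a recursive call splits into the
  -- end of one loop body and the later rounds.
  search : ∀ d j → d + j ≡ k →
           Run (compile f (o ∷ ρ) (1 + o) ⨾ loop (1 + o) body) (o ↦ j ⊕ σ) (o ↦ k ⊕ σ)
  search zero    j refl = run-f eval ⨾
    stop (test (trans (⊕-zero (1 + o) _ (1 + o)) at-flag) λ s → sym (⊕-zero (1 + o) _ s))
  search (suc d) j e with search d (suc j) (trans (+-suc d j) e)
                        | below j (subst (j <_) e (s≤s (m≤n+m j d)))
  ... | x ⨾ y | _ , eval′ =
    run-f eval′ ⨾ step Run-dec (Run-clear at-flag ⨾ Run-inc ⨾ x) y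

run-args [] [] o<p refl holds clean run = run (λ _ → refl) [] clean
run-args {suc m} (g ∷ gs) {o = o} {p} {q} {z} {σ = σ} (_∷_ {y = y} eval evals) o<p e holds clean run =
  run-compile g eval holds clean ⨾
  via (run-args gs evals (m<n⇒m<1+n o<p) (trans e (sym (+-suc m p)))
        (Holds-≤ (n≤1+n p) (Holds-⊕ ≤-refl holds)) (Clean-⊕ ≤-refl clean)
        λ agree holds′ clean′ → run
          (λ s<p → trans (agree (m<n⇒m<1+n s<p)) (⊕-other (<⇒≢ s<p ∘ sym)))
          ((subst (p <_) (sym e) (s≤s (m≤n+m p m)) ,
            trans (agree ≤-refl) (⊕-fresh (clean ≤-refl))) ∷ holds′)
          clean′)
      (⊕-swap o z p y σ)
  (Run-clear (trans (⊕-other (<⇒≢ o<p)) (clean ≤-refl)))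

-- Rewriting of words

data Letter : Set where
  init fin goal : Letter
  cmd           : Cmd → Letter

Word : Set
Word = List Letter

-- Both sides are nonempty because they become products of variables, and the restricted system has
-- no unit for the empty word.
Rule : Set
Rule = List⁺ Letter × List⁺ Letter

infix 3 _⊢_⇝_

data _⊢_⇝_ (R : List Rule) : Word → Word → Set where
  rule   : ∀ {l r} → (l , r) ∈ R → R ⊢ toList l ⇝ toList r
  frameˡ : ∀ u {w w′} → R ⊢ w ⇝ w′ → R ⊢ u ++ w ⇝ u ++ w′
  frameʳ : ∀ {w w′} v → R ⊢ w ⇝ w′ → R ⊢ w ++ v ⇝ w′ ++ v
  ε      : ∀ {w} → R ⊢ w ⇝ w
  _◅◅_   : ∀ {w w′ w″} → R ⊢ w ⇝ w′ → R ⊢ w′ ⇝ w″ → R ⊢ w ⇝ w″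

infixr 4 _◅◅_

marks : List ℕ → Word
marks = map (cmd ∘ mark)

-- A configuration is `init`, then marks that hold the registers in unary and in any order, then the
-- commands still to run. `dec` and `test` act by moving left through the marks.
pass : Letter → ℕ → Rule
pass c m = (cmd (mark m) ∷ c ∷ []) , (c ∷ cmd (mark m) ∷ [])

absorb : Letter → Letter → Letter → Rule
absorb c d e = (c ∷ d ∷ []) , (e ∷ [])

-- `dec r` replaces a mark of register `r` by the neutral `mark 0`, as a right side cannot be empty.
-- `test r` cannot pass a mark of `r`, so on reaching `init` it has shown the register to be empty.
decRules testRules : List ℕ → ℕ → List Rule
decRules  M r = absorb (cmd (mark (suc r))) (cmd (dec r)) (cmd (mark 0)) ∷
                map (pass (cmd (dec r))) M
testRules M r = absorb init (cmd (test r)) init ∷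
                map (pass (cmd (test r))) (filter (λ m → ¬? (m ≟ suc r)) M)

cmdRules : List ℕ → Cmd → List Rule
cmdRules M (mark m)   = []
cmdRules M (dec r)    = decRules M r
cmdRules M (test r)   = testRules M r
cmdRules M (c ⨾ d)    = (cmd (c ⨾ d) ∷ [] , cmd c ∷ cmd d ∷ []) ∷ cmdRules M c ++ cmdRules M d
cmdRules M (loop r c) =
  -- The choice between the two loop rules is free; `test r` or `dec r` rejects a wrong guess.
  (cmd (loop r c) ∷ [] , cmd (test r) ∷ []) ∷
  (cmd (loop r c) ∷ [] , cmd (dec r) ∷ cmd c ∷ cmd (loop r c) ∷ []) ∷
  decRules M r ++ testRules M r ++ cmdRules M c

finRules : List ℕ → List Rule
finRules M = absorb init fin goal ∷ map (λ m → absorb (cmd (mark m)) fin fin) M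

marksOf : Cmd → List ℕ
marksOf (mark m)   = m ∷ []
marksOf (dec r)    = []
marksOf (test r)   = []
marksOf (c ⨾ d)    = marksOf c ++ marksOf d
marksOf (loop r c) = marksOf c

tally : List ℕ → State
tally []      s = 0
tally (m ∷ u) s = δ m (suc s) + tally u s

tally-++ : ∀ u {v} s → tally (u ++ v) s ≡ tally u s + tally v s
tally-++ []      s = refl
tally-++ (m ∷ u) s =
  trans (cong (δ m (suc s) +_) (tally-++ u s)) (sym (+-assoc (δ m (suc s)) _ _))

tally-∈ : ∀ r u → tally u r ≢ 0 → suc r ∈ u
tally-∈ r []      nz = ⊥-elim (nz refl)
tally-∈ r (m ∷ u) nz with m ≟ suc r
... | yes refl = here refl
... | no m≢r   = there (tally-∈ r u (nz ∘ trans (cong (_+ tally u r) (δ-≢ m≢r))))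

tally-≢0 : ∀ {r u} → suc r ∈ u → tally u r ≢ 0
tally-≢0 {r} {_ ∷ u} (here refl) e with trans (sym e) (cong (_+ tally u r) (δ-diag r))
... | ()
tally-≢0 {r} {m ∷ u} (there p)   e = tally-≢0 p (m+n≡0⇒n≡0 (δ m (suc r)) e)

module _ {R : List Rule} where

  pass-marks : ∀ {c} u → All (λ m → pass c m ∈ R) u → R ⊢ marks u ++ c ∷ [] ⇝ c ∷ marks u
  pass-marks []      []       = ε
  pass-marks (m ∷ u) (p ∷ ps) =
    frameˡ (cmd (mark m) ∷ []) (pass-marks u ps) ◅◅ frameʳ (marks u) (rule p)

  absorb-marks : ∀ {c} u → All (λ m → absorb (cmd (mark m)) c c ∈ R) u →
                 R ⊢ marks u ++ c ∷ [] ⇝ c ∷ []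
  absorb-marks []      []       = ε
  absorb-marks (m ∷ u) (p ∷ ps) =
    frameˡ (cmd (mark m) ∷ []) (absorb-marks u ps) ◅◅ rule p

  module _ (M : List ℕ) (0∈M : 0 ∈ M) where

    -- `u` is arbitrary since a state fixes neither the order of the marks nor the number of neutral
    -- ones.
    Rewrites : State → Word → State → Set
    Rewrites σ w τ = ∀ {u} → u ⊆ M → tally u ≗ σ → ∃ λ v → v ⊆ M × tally v ≗ τ ×
      (R ⊢ init ∷ marks u ++ w ⇝ init ∷ marks v)

    infixr 5 _▹_

    _▹_ : ∀ {w w′ ρ σ τ} → Rewrites ρ w σ → Rewrites σ w′ τ → Rewrites ρ (w ++ w′) τ
    _▹_ {w} {w′} x y {u} u⊆M e with x u⊆M e
    ... | v , v⊆M , e′ , p with y v⊆M e′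
    ... | t , t⊆M , e″ , q = t , t⊆M , e″ ,
      (subst (R ⊢_⇝ init ∷ marks v ++ w′) (++-assoc (init ∷ marks u) w w′) (frameʳ w′ p) ◅◅ q)

    unfold : ∀ {w w′ σ τ} → (w , w′) ∈ R → Rewrites σ (toList w′) τ → Rewrites σ (toList w) τ
    unfold r x {u} u⊆M e with x u⊆M e
    ... | v , v⊆M , e′ , p = v , v⊆M , e′ , (frameˡ (init ∷ marks u) (rule r) ◅◅ p)

    rewrite-dec : ∀ {r σ τ} → decRules M r ⊆ R → Run (dec r) σ τ → Rewrites σ (cmd (dec r) ∷ []) τ
    rewrite-dec {r} sub d@(dec h) {u} u⊆M e
      -- Register `r` is positive, so `u` contains a mark of it; `dec r` passes the part `u₂` to the
      -- right of that mark.
      with ∈-∃++ (tally-∈ r u (dec-positive d ∘ trans (sym (e r))))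
    ... | u₁ , u₂ , refl = u₁ ++ 0 ∷ u₂ , v⊆M , v≗τ ,
      subst₂ (R ⊢_⇝_) regroup (cong (init ∷_) (sym (map-++ _ u₁ (0 ∷ u₂))))
        (frameˡ (init ∷ marks u₁)
          (frameˡ (cmd (mark (suc r)) ∷ [])
            (pass-marks u₂ (All.tabulate λ p → sub (there (∈-map⁺ _ (u⊆M (∈-++⁺ʳ u₁ (there p))))))) ◅◅
           frameʳ (marks u₂) (rule (sub (here refl)))))
      where
      v⊆M : u₁ ++ 0 ∷ u₂ ⊆ M
      v⊆M p with ∈-++⁻ u₁ p
      ... | inj₁ q           = u⊆M (∈-++⁺ˡ q)
      ... | inj₂ (here refl) = 0∈M
      ... | inj₂ (there q)   = u⊆M (∈-++⁺ʳ u₁ (there q))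
      v≗τ : tally (u₁ ++ 0 ∷ u₂) ≗ _
      v≗τ s = +-cancelˡ-≡ (δ r s) _ _ (trans
        (trans (cong (δ r s +_) (tally-++ u₁ s)) (+-swap (δ r s) (tally u₁ s) (tally u₂ s)))
        (trans (sym (tally-++ u₁ s)) (trans (e s) (h s))))
      regroup : init ∷ marks u₁ ++ cmd (mark (suc r)) ∷ marks u₂ ++ cmd (dec r) ∷ [] ≡
                init ∷ marks (u₁ ++ suc r ∷ u₂) ++ cmd (dec r) ∷ []
      regroup = cong (init ∷_) (trans (sym (++-assoc (marks u₁) _ _))
        (cong (_++ cmd (dec r) ∷ []) (sym (map-++ _ u₁ (suc r ∷ u₂)))))

    rewrite-test : ∀ {r σ τ} → testRules M r ⊆ R → Run (test r) σ τ → Rewrites σ (cmd (test r) ∷ []) τ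
    rewrite-test {r} sub (test z h) {u} u⊆M e = u , u⊆M , (λ s → trans (e s) (sym (h s))) ,
      (frameˡ (init ∷ []) (pass-marks u (All.tabulate λ p →
        sub (there (∈-map⁺ _ (∈-filter⁺ _ (u⊆M p)
          λ { refl → tally-≢0 p (trans (e r) z) }))))) ◅◅
      frameʳ (marks u) (rule (sub (here refl))))

    rewrite-run : ∀ {c σ τ} → cmdRules M c ⊆ R → marksOf c ⊆ M → Run c σ τ →
                  Rewrites σ (cmd c ∷ []) τ
    rewrite-run sub m⊆M (mark {m} h) {u} u⊆M e = u ++ m ∷ [] ,
      (λ p → [ u⊆M , (λ { (here refl) → m⊆M (here refl) }) ]′ (∈-++⁻ u p)) ,
      (λ s → trans (tally-++ u s) (trans (+-comm (tally u s) _)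
        (trans (cong₂ _+_ (+-identityʳ _) (e s)) (sym (h s))))) ,
      subst (R ⊢ init ∷ marks u ++ cmd (mark m) ∷ [] ⇝_)
        (cong (init ∷_) (sym (map-++ _ u (m ∷ [])))) ε
    rewrite-run sub m⊆M d@(dec _) = rewrite-dec sub d
    rewrite-run sub m⊆M t@(test _ _) = rewrite-test sub t
    rewrite-run {c ⨾ d} sub m⊆M (x ⨾ y) = unfold (sub (here refl))
      (rewrite-run (sub ∘ there ∘ ∈-++⁺ˡ) (m⊆M ∘ ∈-++⁺ˡ) x ▹
       rewrite-run (sub ∘ there ∘ ∈-++⁺ʳ (cmdRules M c)) (m⊆M ∘ ∈-++⁺ʳ (marksOf c)) y)
    rewrite-run {loop r c} sub m⊆M (stop x) = unfold (sub (here refl))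
      (rewrite-test (sub ∘ there ∘ there ∘ ∈-++⁺ʳ (decRules M r) ∘ ∈-++⁺ˡ) x)
    rewrite-run {loop r c} sub m⊆M (step x y z) = unfold (sub (there (here refl)))
      (rewrite-dec (sub ∘ there ∘ there ∘ ∈-++⁺ˡ) x ▹
       rewrite-run (sub ∘ there ∘ there ∘ ∈-++⁺ʳ (decRules M r) ∘ ∈-++⁺ʳ (testRules M r)) m⊆M y ▹
       rewrite-run sub m⊆M z)

    rewrite-fin : finRules M ⊆ R → ∀ {u} → u ⊆ M → R ⊢ init ∷ marks u ++ fin ∷ [] ⇝ goal ∷ []
    rewrite-fin sub {u} u⊆M =
      frameˡ (init ∷ []) (absorb-marks u (All.tabulate λ p → sub (there (∈-map⁺ _ (u⊆M p))))) ◅◅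
      rule (sub (here refl))

-- Runs of letters and soundness of the rules

-- `init` reaches only the empty state, so a test after it succeeds; `fin` and `goal` reach every
-- state, so a run of `goal` is also one of `init` followed by `fin`.
Letter-Run : Letter → State → State → Set
Letter-Run init    σ τ = ∀ s → τ s ≡ 0
Letter-Run fin     σ τ = ⊤
Letter-Run goal    σ τ = ⊤
Letter-Run (cmd c) σ τ = Run c σ τ

Word-Run : Letter → Word → State → State → Set
Word-Run c []       ρ τ = Letter-Run c ρ τ
Word-Run c (d ∷ ds) ρ τ = ∃ λ σ → Letter-Run c ρ σ × Word-Run d ds σ τ

-- Rewriting may only lose runs. As `goal` has runs, a word that rewrites to it has one too.
Sound : Rule → Set
Sound (c ∷ l , d ∷ r) = ∀ {σ τ} → Word-Run d r σ τ → Word-Run c l σ τ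

decRules-sound : ∀ M r → All Sound (decRules M r)
decRules-sound M r =
  (λ { {σ} (mark h) → (λ s → δ r s + σ s) , mark (λ _ → refl) ,
         dec λ s → cong (δ r s +_) (sym (h s)) }) ∷
  All.map⁺ (All.tabulate λ {m} _ →
    λ { {σ} (ρ , dec h , mark h′) → (λ s → δ m (suc s) + σ s) , mark (λ _ → refl) ,
         dec λ s → trans (cong (δ m (suc s) +_) (h s))
           (trans (+-swap (δ m (suc s)) (δ r s) (ρ s)) (cong (δ r s +_) (sym (h′ s)))) })

testRules-sound : ∀ M r → All Sound (testRules M r)
testRules-sound M r =
  (λ {_} {τ} h → τ , h , test (h r) λ _ → refl) ∷
  All.map⁺ (All.map
    -- Since `m` is not a mark of `r`, register `r` is still empty when the test comes after it.
    (λ {m} m≢r → λ { {σ} (ρ , test z h , mark h′) →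
      (λ s → δ m (suc s) + σ s) , mark (λ _ → refl) ,
      test (cong₂ _+_ (δ-≢ m≢r) z)
           λ s → trans (h′ s) (cong (δ m (suc s) +_) (h s)) })
    (All.all-filter (λ m → ¬? (m ≟ suc r)) M))

cmdRules-sound : ∀ M c → All Sound (cmdRules M c)
cmdRules-sound M (mark m)   = []
cmdRules-sound M (dec r)    = decRules-sound M r
cmdRules-sound M (test r)   = testRules-sound M r
cmdRules-sound M (c ⨾ d)    =
  (λ (_ , x , y) → x ⨾ y) ∷ All.++⁺ (cmdRules-sound M c) (cmdRules-sound M d)
cmdRules-sound M (loop r c) =
  stop ∷ (λ (_ , x , _ , y , z) → step x y z) ∷
  All.++⁺ (decRules-sound M r) (All.++⁺ (testRules-sound M r) (cmdRules-sound M c))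

finRules-sound : ∀ M → All Sound (finRules M)
finRules-sound M =
  (λ _ → (λ _ → 0) , (λ _ → refl) , tt) ∷
  All.map⁺ (All.tabulate λ {m} _ {σ} _ → (λ s → δ m (suc s) + σ s) , mark (λ _ → refl) , tt)

-- Codes

pair-zero : ∀ y → pair 0 y ≡ suc (2 * y)
pair-zero = expand
  where
  expand : ∀ y → 1 * (2 * y + 1) ≡ suc (2 * y)
  expand = solve-∀

pair-suc : ∀ x y → pair (suc x) y ≡ 2 * pair x y
pair-suc x y = *-assoc 2 (2 ^ x) (2 * y + 1)

pair-injective : ∀ x y x′ y′ → pair x y ≡ pair x′ y′ → x ≡ x′ × y ≡ y′
pair-injective zero y zero y′ e =
  refl , *-cancelˡ-≡ y y′ 2 (suc-injective (trans (sym (pair-zero y)) (trans e (pair-zero y′))))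
pair-injective zero y (suc x′) y′ e =
  ⊥-elim (even≢odd (pair x′ y′) y (trans (sym (pair-suc x′ y′)) (trans (sym e) (pair-zero y))))
pair-injective (suc x) y zero y′ e =
  ⊥-elim (even≢odd (pair x y) y′ (trans (sym (pair-suc x y)) (trans e (pair-zero y′))))
pair-injective (suc x) y (suc x′) y′ e
  with pair-injective x y x′ y′
         (*-cancelˡ-≡ _ _ 2 (trans (sym (pair-suc x y)) (trans e (pair-suc x′ y′))))
... | refl , refl = refl , refl

tag : Cmd → ℕ
tag (mark _)   = 0
tag (dec _)    = 1
tag (test _)   = 2
tag (_ ⨾ _)    = 3
tag (loop _ _) = 4

codeCmd payload : Cmd → ℕ
codeCmd c = pair (tag c) (payload c)
payload (mark m)   = m
payload (dec r)    = r
payload (test r)   = r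
payload (c ⨾ d)    = pair (codeCmd c) (codeCmd d)
payload (loop r c) = pair r (codeCmd c)

codeCmd-injective : ∀ c d → codeCmd c ≡ codeCmd d → c ≡ d
payload-injective : ∀ c d → tag c ≡ tag d → payload c ≡ payload d → c ≡ d

codeCmd-injective c d e =
  let p , q = pair-injective (tag c) (payload c) (tag d) (payload d) e in
  payload-injective c d p q

payload-injective (mark _) (mark _) refl refl = refl
payload-injective (dec _)  (dec _)  refl refl = refl
payload-injective (test _) (test _) refl refl = refl
payload-injective (c ⨾ d) (c′ ⨾ d′) refl e =
  let p , q = pair-injective (codeCmd c) (codeCmd d) (codeCmd c′) (codeCmd d′) e in
  cong₂ _⨾_ (codeCmd-injective c c′ p) (codeCmd-injective d d′ q)
payload-injective (loop r c) (loop r′ c′) refl e =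
  let p , q = pair-injective r (codeCmd c) r′ (codeCmd c′) e in
  cong₂ loop p (codeCmd-injective c c′ q)

-- Opaque, so that a letter can be inferred from its code.
opaque

  codeLetter : Letter → ℕ
  codeLetter init    = 0
  codeLetter fin     = 1
  codeLetter goal    = 2
  codeLetter (cmd c) = 3 + codeCmd c

  codeLetter-injective : ∀ c d → codeLetter c ≡ codeLetter d → c ≡ d
  codeLetter-injective init    init    e = refl
  codeLetter-injective fin     fin     e = refl
  codeLetter-injective goal    goal    e = refl
  codeLetter-injective (cmd c) (cmd d) e =
    cong cmd (codeCmd-injective c d (suc-injective (suc-injective (suc-injective e))))

double : Rec 1
double = prec zer (comp succ (comp succ (proj (suc zero) ∷ []) ∷ []))

double-⇓ : ∀ n → double ⟪ n ∷ [] ⟫⇓ 2 * n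
double-⇓ zero    = ⇓prec-zero ⇓zer
double-⇓ (suc n) = ⇓prec-suc (double-⇓ n)
  (⇓comp (⇓comp (⇓proj ∷ []) ⇓succ ∷ [])
    (subst (succ ⟪ suc (2 * n) ∷ [] ⟫⇓_) (sym (*-suc 2 n)) ⇓succ))

-- The first component is a constant wherever codes are computed, so iterated doubling suffices.
pairRec : ℕ → Rec 1
pairRec zero    = comp succ (double ∷ [])
pairRec (suc x) = comp double (pairRec x ∷ [])

pairRec-⇓ : ∀ x y → pairRec x ⟪ y ∷ [] ⟫⇓ pair x y
pairRec-⇓ zero    y = subst (pairRec zero ⟪ y ∷ [] ⟫⇓_) (sym (pair-zero y)) (⇓comp (double-⇓ y ∷ []) ⇓succ)
pairRec-⇓ (suc x) y = subst (pairRec (suc x) ⟪ y ∷ [] ⟫⇓_) (sym (pair-suc x y))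
  (⇓comp (pairRec-⇓ x y ∷ []) (double-⇓ (pair x y)))

-- Derivations

module _ {S : System} where

  letter : Letter → Formula S mult
  letter c = var (codeLetter c)

  word : Word → MetaFormula S mult
  word = map (fm ∘ letter)

  product : Letter → Word → Formula S mult
  product c []      = letter c
  product c (d ∷ w) = letter c · product d w

  ruleFormula : Rule → Formula S mult
  ruleFormula (c ∷ l , d ∷ r) = product c l ∖ product d r

  -- The variable t of the tokens. Runs of `mark 0` change nothing; hence in the model it relates a
  -- set only to its supersets.
  unit : Formula S mult
  unit = letter (cmd (mark 0))

  product-R : ∀ c w → Derivable (word (c ∷ w) ⟶ product c w)
  product-R c []      = ax
  product-R c (d ∷ w) = ·R ax (product-R d w)

  cast : ∀ {Ξ Ξ′} {C : Formula S mult} → Ξ ≡ Ξ′ → Derivable (Ξ ⟶ C) → Derivable (Ξ′ ⟶ C)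
  cast refl d = d

  product-L : ∀ {C} Γ c w {Δ} → Derivable (Γ ++ word (c ∷ w) ++ Δ ⟶ C) →
              Derivable (Γ ++ fm (product c w) ∷ Δ ⟶ C)
  product-L Γ c []      d = d
  product-L Γ c (e ∷ w) d = ·L hole (cast (∷ʳ-++ Γ (fm (letter c)) _)
    (product-L (Γ ++ _ ∷ []) e w (cast (sym (∷ʳ-++ Γ (fm (letter c)) _)) d)))

  fire : ∀ {A B C} Γ Φ Ψ Δ → Derivable (Φ ⟶ A) → Derivable (Γ ++ fm B ∷ Ψ ++ Δ ⟶ C) →
         Derivable (Γ ++ Φ ++ Ψ ++ fm (! (A ∖ B)) ∷ Δ ⟶ C)
  fire Γ Φ Ψ Δ d e = cast (++-assoc Γ Φ _)
    (!P₁ {Φ = Ψ} {Γ ++ Φ} {Δ} hole (!L {Δ₁ = Γ ++ Φ} hole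
      (cast (sym (++-assoc Γ Φ _)) (∖L hole d e))))

token : ∀ S → TreeTerm S mult
token F₂₀₁₅  = fm unit
token F₂₀₁₈  = [ [ fm unit ∷ [] ] ∷ [] ]
token F₂₀₁₈⁻ = [ [ fm unit ∷ [] ] ∷ [] ]

tokenFormula : ∀ S → Formula S mult
tokenFormula F₂₀₁₅  = unit
tokenFormula F₂₀₁₈  = ⟨⟩ ⟨⟩ unit
tokenFormula F₂₀₁₈⁻ = ⟨⟩ ⟨⟩ unit

token-R : ∀ S → Derivable (token S ∷ [] ⟶ tokenFormula S)
token-R F₂₀₁₅  = ax
token-R F₂₀₁₈  = ⟨⟩R (⟨⟩R ax)
token-R F₂₀₁₈⁻ = ⟨⟩R (⟨⟩R ax)

token-L : ∀ S {C} Γ {Δ} → Derivable (Γ ++ token S ∷ Δ ⟶ C) →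
          Derivable (Γ ++ fm (tokenFormula S) ∷ Δ ⟶ C)
token-L F₂₀₁₅  Γ d = d
token-L F₂₀₁₈  Γ {Δ} d = ⟨⟩L hole (⟨⟩L {Δ₁ = []} (inside Γ hole Δ) d)
token-L F₂₀₁₈⁻ Γ {Δ} d = ⟨⟩L hole (⟨⟩L {Δ₁ = []} (inside Γ hole Δ) d)

-- The bracket made by contraction contains `unit` besides `! A`, so Lambek's restriction on `Γ₂` is
-- met.
contract : ∀ S {A C} Γ {Δ} →
           Derivable (fm (! A) ∷ Γ ++ [ fm (! A) ∷ fm unit ∷ [] ] ∷ Δ ⟶ C) →
           Derivable (fm (! A) ∷ Γ ++ token S ∷ Δ ⟶ C)
contract F₂₀₁₅  Γ d = !C₂₀₁₅ {As = []} {Γ₁ = Γ} {fm unit ∷ []} hole tt d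
contract F₂₀₁₈  Γ d = !C₂₀₁₈ hole tt (λ _ ()) d
contract F₂₀₁₈⁻ Γ d = !C₂₀₁₈ hole tt (λ _ ()) d

module _ {S : System} where

  copier : Formula S mult → Formula S mult
  copier B = []⁻¹ (! B · tokenFormula S) / unit

  -- From the conclusion upwards: contraction puts a copy of the copier into a bracket with `unit`,
  -- `/L` consumes `unit`, `[]⁻¹L` removes the bracket, and the remaining product is unpacked into
  -- `! B` and a new token.
  spawn : ∀ {B C} Γ₁ Γ₂ Δ →
    Derivable (Γ₁ ++ fm (! copier B) ∷ Γ₂ ++ fm (! B) ∷ token S ∷ Δ ⟶ C) →
    Derivable (Γ₁ ++ fm (! copier B) ∷ Γ₂ ++ token S ∷ Δ ⟶ C)
  spawn {B} {C} Γ₁ Γ₂ Δ d =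
    !P₁ {Φ = Γ₁} {[]} hole
      (cast (cong (fm (! copier B) ∷_) (++-assoc Γ₁ Γ₂ _))
        (contract S (Γ₁ ++ Γ₂)
          (!L {Δ₁ = []} (inside Γ hole Δ)
            (/L {Γ = fm unit ∷ []} {Δ₁ = []} {[]} (inside Γ hole Δ) ax
              ([]⁻¹L {Δ₁ = Γ} hole
                (·L {Δ₁ = Γ} hole
                  (cast (∷ʳ-++ Γ (fm (! B)) _)
                    (token-L S (Γ ++ fm (! B) ∷ [])
                      (cast (sym (∷ʳ-++ Γ (fm (! B)) _))
                        (cast (cong (fm (! copier B) ∷_) (sym (++-assoc Γ₁ Γ₂ _)))
                          (!P₂ {Φ = Γ₁} {[]} hole d)))))))))))
    where
    Γ : MetaFormula S mult
    Γ = fm (! copier B) ∷ Γ₁ ++ Γ₂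

  copiers : List Rule → List (Formula S mult)
  copiers = map (copier ∘ ruleFormula)

  -- The copier of the rule spawns its formula, which acts on the left side in place; copiers and
  -- token survive for the next step. `u` and `v` collect the frames.
  rewrite-L : ∀ {R C Δ} {w w′ : Word} → R ⊢ w ⇝ w′ → ∀ u v →
    Derivable (word (u ++ w′ ++ v) ++ bangs (copiers R) ++ token S ∷ Δ ⟶ C) →
    Derivable (word (u ++ w ++ v) ++ bangs (copiers R) ++ token S ∷ Δ ⟶ C)
  rewrite-L {R} {C} {Δ} (rule {c ∷ l} {e ∷ r} r∈R) u v d
    with ∈-∃++ (∈-map⁺ (λ A → fm (! A)) (∈-map⁺ (copier ∘ ruleFormula) r∈R))
  ... | Γ₁ , Γ₂ , eq = cast (borrow _)
    (spawn (word (u ++ c ∷ l ++ v) ++ Γ₁) Γ₂ Δ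
      (cast (sym (trans (borrow _) (spread (c ∷ l) _)))
        (fire (word u) (word (c ∷ l)) (word v ++ bangs (copiers R)) (token S ∷ Δ) (product-R c l)
          (product-L (word u) e r (cast (spread (e ∷ r) _) d)))))
    where
    A : TreeTerm S mult
    A = fm (! copier (ruleFormula (c ∷ l , e ∷ r)))
    borrow : ∀ Θ → (word (u ++ c ∷ l ++ v) ++ Γ₁) ++ A ∷ Γ₂ ++ Θ ≡
                   word (u ++ c ∷ l ++ v) ++ bangs (copiers R) ++ Θ
    borrow Θ = trans (++-assoc (word (u ++ c ∷ l ++ v)) Γ₁ _)
      (cong (word (u ++ c ∷ l ++ v) ++_)
        (sym (trans (cong (_++ Θ) eq) (++-assoc Γ₁ (A ∷ Γ₂) Θ))))
    spread : ∀ w Θ → word (u ++ w ++ v) ++ bangs (copiers R) ++ Θ ≡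
                     word u ++ word w ++ (word v ++ bangs (copiers R)) ++ Θ
    spread w Θ = begin
      word (u ++ w ++ v) ++ B ++ Θ               ≡⟨ cong (_++ B ++ Θ) (map-++ _ u (w ++ v)) ⟩
      (word u ++ word (w ++ v)) ++ B ++ Θ        ≡⟨ ++-assoc (word u) _ _ ⟩
      word u ++ word (w ++ v) ++ B ++ Θ          ≡⟨ cong (λ x → word u ++ x ++ B ++ Θ) (map-++ _ w v) ⟩
      word u ++ (word w ++ word v) ++ B ++ Θ     ≡⟨ cong (word u ++_) (++-assoc (word w) _ _) ⟩
      word u ++ word w ++ word v ++ B ++ Θ       ≡⟨ cong (λ x → word u ++ word w ++ x) (sym (++-assoc (word v) B Θ)) ⟩
      word u ++ word w ++ (word v ++ B) ++ Θ     ∎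
      where
      open ≡-Reasoning
      B : MetaFormula S mult
      B = bangs (copiers R)
  rewrite-L (frameˡ u′ {w} {w′} p) u v d =
    cast (cong (λ x → word x ++ _) (assoc w)) (rewrite-L p (u ++ u′) v
      (cast (cong (λ x → word x ++ _) (sym (assoc w′))) d))
    where
    assoc : ∀ w → (u ++ u′) ++ w ++ v ≡ u ++ (u′ ++ w) ++ v
    assoc w = trans (++-assoc u u′ _) (cong (u ++_) (sym (++-assoc u′ w v)))
  rewrite-L (frameʳ {w} {w′} v′ p) u v d =
    cast (cong (λ x → word (u ++ x) ++ _) (sym (++-assoc w v′ v))) (rewrite-L p u (v′ ++ v)
      (cast (cong (λ x → word (u ++ x) ++ _) (++-assoc w′ v′ v)) d))
  rewrite-L ε        u v d = d
  rewrite-L (p ◅◅ q) u v d = rewrite-L p u v (rewrite-L q u v d)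

  gather : List (Formula S mult) → Formula S mult
  gather []       = tokenFormula S
  gather (A ∷ As) = ! A · gather As

  gather-R : ∀ As → Derivable (bangs As ++ token S ∷ [] ⟶ gather As)
  gather-R []       = token-R S
  gather-R (A ∷ As) = ·R ax (gather-R As)

  -- `!` admits no weakening here, so this formula consumes the copiers and the token that remain
  -- when `goal` is reached.
  cleanup : List (Formula S mult) → Formula S mult
  cleanup As = (letter goal · gather As) ∖ letter goal

  cleanup-L : ∀ As → Derivable (fm (letter goal) ∷ bangs As ++ token S ∷ fm (cleanup As) ∷ [] ⟶ letter goal)
  cleanup-L As = cast (cong (_ ∷_) (++-assoc (bangs As) (token S ∷ []) _))
    (∖L {Γ = fm (letter goal) ∷ bangs As ++ token S ∷ []} {Δ₁ = []} hole (·R ax (gather-R As)) ax)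

  -- The antecedent after the input. It does not depend on the input, so its own code can serve as
  -- one.
  suffix : List Rule → Cmd → MetaFormula S mult
  suffix R c = word (cmd c ∷ fin ∷ []) ++ bangs (copiers R) ++ token S ∷ fm (cleanup (copiers R)) ∷ []

  numeral : ℕ → MetaFormula S mult
  numeral n = replicate n (fm (letter (cmd (inc 0))))

  query : ℕ → MetaFormula S mult → Sequent S mult
  query n Γ = fm (letter init) ∷ numeral n ++ Γ ⟶ letter goal

-- The recursive function behind the diagonal argument

module _ {S F} (s t : TreeTerm S F) (C : Formula S F) where

  repeatRec : Rec 2
  repeatRec = prec (proj zero) (comp (pairRec (codeTreeTerm t)) (proj (suc zero) ∷ []))

  -- Uses its argument twice: as the code of `Γ` and as the number of copies of `t` put before `Γ`.
  diagonalRec : Rec 1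
  diagonalRec = comp (pairRec (codeFormula C)) (comp (pairRec (codeTreeTerm s))
    (comp repeatRec (proj zero ∷ proj zero ∷ []) ∷ []) ∷ [])

  repeatRec-⇓ : ∀ Γ n → repeatRec ⟪ n ∷ codeMetaFormula Γ ∷ [] ⟫⇓ codeMetaFormula (replicate n t ++ Γ)
  repeatRec-⇓ Γ zero    = ⇓prec-zero ⇓proj
  repeatRec-⇓ Γ (suc n) = ⇓prec-suc (repeatRec-⇓ Γ n) (⇓comp (⇓proj ∷ []) (pairRec-⇓ (codeTreeTerm t) _))

  diagonalRec-⇓ : ∀ Γ → diagonalRec ⟪ codeMetaFormula Γ ∷ [] ⟫⇓
                  codeSequent (s ∷ replicate (codeMetaFormula Γ) t ++ Γ ⟶ C)
  diagonalRec-⇓ Γ =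
    ⇓comp (⇓comp (⇓comp (⇓proj ∷ ⇓proj ∷ []) (repeatRec-⇓ Γ (codeMetaFormula Γ)) ∷ [])
      (pairRec-⇓ (codeTreeTerm s) _) ∷ []) (pairRec-⇓ (codeFormula C) _)

start : ℕ → State
start n = 0 ↦ n ⊕ λ _ → 0

-- The machine as a sequent

-- The rules must be finitely many, so they mention only marks that can occur: those of the program,
-- `0` left by decrements, and `1` for the input in register 0.
marksFor : Cmd → List ℕ
marksFor c = 0 ∷ 1 ∷ marksOf c

rulesFor : Cmd → List Rule
rulesFor c = cmdRules (marksFor c) c ++ finRules (marksFor c)

ones : ℕ → List ℕ
ones n = replicate n 1

tally-ones : ∀ n → tally (ones n) ≗ start n
tally-ones zero    s = sym (⊕-zero 0 _ s)
tally-ones (suc n) s = trans (cong (δ 0 s +_) (tally-ones n s)) (sym (⊕-suc 0 n _ s))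

halts⇒rewrites : ∀ {c n τ} → Run c (start n) τ →
                 rulesFor c ⊢ init ∷ marks (ones n) ++ cmd c ∷ fin ∷ [] ⇝ goal ∷ []
halts⇒rewrites {c} {n} x
  with rewrite-run (marksFor c) (here refl) {c} ∈-++⁺ˡ (there ∘ there) x
         (All.lookup {P = _∈ marksFor c} (All.replicate⁺ n (there (here refl)))) (tally-ones n)
... | v , v⊆M , _ , p =
  subst (rulesFor c ⊢_⇝ init ∷ marks v ++ fin ∷ []) (++-assoc (init ∷ marks (ones n)) _ _)
    (frameʳ (fin ∷ []) p) ◅◅
  rewrite-fin (marksFor c) (here refl) (∈-++⁺ʳ (cmdRules (marksFor c) c)) v⊆M

halts⇒derivable : ∀ {S c n τ} → Run c (start n) τ → Derivable (query {S} n (suffix (rulesFor c) c))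
halts⇒derivable {S} {c} {n} x = cast (cong (fm (letter init) ∷_) (shape n))
  (rewrite-L (halts⇒rewrites {c} {n} x) [] [] (cleanup-L (copiers (rulesFor c))))
  where
  shape : ∀ n {Δ} → word ((marks (ones n) ++ cmd c ∷ fin ∷ []) ++ []) ++ Δ ≡
          numeral n ++ word (cmd c ∷ fin ∷ []) ++ Δ
  shape zero    = refl
  shape (suc n) = cong (fm (letter (cmd (inc 0))) ∷_) (shape n)

-- The model on sets of states

-- The strongest postcondition: the least set to which the letter relates `K`.
Image : Letter → (State → Set) → State → Set
Image c K τ = ∃ λ σ → K σ × Letter-Run c σ τ

opaque

  -- A letter relates K to K′ when running it from K ends in K′; so its
  -- denotation shrinks as its behaviour grows, and a rule l ⇝ r is valid when
  -- every run of r is a run of l.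
  valuation : ℕ → (State → Set) → (State → Set) → Set₁
  valuation i K K′ = Lift (lsuc 0ℓ)
    (∀ c → codeLetter c ≡ i → ∀ {σ τ} → K σ → Letter-Run c σ τ → K′ τ)

  letter⁺ : ∀ {c K K′} → (∀ {σ τ} → K σ → Letter-Run c σ τ → K′ τ) →
            valuation (codeLetter c) K K′
  letter⁺ {c} h = lift λ d e → subst (λ d → ∀ {σ τ} → _ → Letter-Run d σ τ → _)
    (sym (codeLetter-injective d c e)) h

  letter⁻ : ∀ {c K K′} → valuation (codeLetter c) K K′ →
            ∀ {σ τ} → K σ → Letter-Run c σ τ → K′ τ
  letter⁻ h = lower h _ refl

letter-image : ∀ c {K} → valuation (codeLetter c) K (Image c K)
letter-image c = letter⁺ λ k x → _ , k , x

skip : ℕ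
skip = codeLetter (cmd (mark 0))

skip-closed : ∀ {K K′} → valuation skip K K′ → ∀ {σ} → K σ → K′ σ
skip-closed p k = letter⁻ p k (mark λ _ → refl)

module _ {S : System} where

  open Relational valuation {S}

  product⁺ : ∀ c w {K K′} → (∀ {σ τ} → K σ → Word-Run c w σ τ → K′ τ) → ⟦ product c w ⟧ K K′
  product⁺ c []      h = letter⁺ h
  product⁺ c (d ∷ w) {K} h = Image c K , letter-image c ,
    product⁺ d w λ (ρ , k , x) y → h k (_ , x , y)

  product⁻ : ∀ c w {K K′} → ⟦ product c w ⟧ K K′ → ∀ {σ τ} → K σ → Word-Run c w σ τ → K′ τ
  product⁻ c []      p           = letter⁻ p
  product⁻ c (d ∷ w) (_ , p , q) k (_ , x , y) = product⁻ d w q (letter⁻ p k x) y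

  ruleFormula-valid : ∀ r → Sound r → ∀ K → ⟦ ruleFormula r ⟧ K K
  ruleFormula-valid (c ∷ l , d ∷ r) sound K J p =
    product⁺ d r λ k x → product⁻ c l p k (sound x)

module _ where

  open Relational valuation

  tokenFormula⁺ : ∀ S {K K′} → valuation skip K K′ → ⟦ tokenFormula S ⟧ K K′
  tokenFormula⁺ F₂₀₁₅  p = p
  tokenFormula⁺ F₂₀₁₈  p = p
  tokenFormula⁺ F₂₀₁₈⁻ p = p

  tokenFormula⁻ : ∀ S {K K′} → ⟦ tokenFormula S ⟧ K K′ → valuation skip K K′
  tokenFormula⁻ F₂₀₁₅  p = p
  tokenFormula⁻ F₂₀₁₈  p = p
  tokenFormula⁻ F₂₀₁₈⁻ p = p

  token⁺ : ∀ S {K K′} → valuation skip K K′ → Term (token S) K K′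
  token⁺ F₂₀₁₅  p = fm p
  token⁺ F₂₀₁₈  p = [ [ fm p ∷ [] ] ∷ [] ]
  token⁺ F₂₀₁₈⁻ p = [ [ fm p ∷ [] ] ∷ [] ]

module _ {S : System} where

  open Relational valuation {S}

  copier-valid : ∀ r → Sound r → ∀ K → ⟦ copier (ruleFormula r) ⟧ K K
  copier-valid r sound K K′ p = K , (refl , ruleFormula-valid r sound) , tokenFormula⁺ S p

  bangs-valid : ∀ {R} → All Sound R → ∀ K → Chain (bangs (copiers R)) K K
  bangs-valid []                 K = []
  bangs-valid (_∷_ {r} sound ss) K = fm (refl , copier-valid r sound) ∷ bangs-valid ss K

  gather⁻ : ∀ As {K K′} → ⟦ gather As ⟧ K K′ → valuation skip K K′
  gather⁻ []       p                    = tokenFormula⁻ S p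
  gather⁻ (A ∷ As) (_ , (refl , _) , p) = gather⁻ As p

  cleanup-valid : ∀ As K → ⟦ cleanup As ⟧ K K
  cleanup-valid As K J (_ , p , q) =
    letter⁺ λ j x → skip-closed (gather⁻ As q) (letter⁻ p j x)

  Everything : State → Set
  Everything _ = ⊤

  -- Each letter leads to its strongest postcondition; by determinism that set stays within one
  -- state, up to pointwise equality, if `K` does.
  numeral-chain : ∀ n {K} → ∃ λ K′ → Chain (numeral n) K K′ ×
    (∀ m → (∀ {σ} → K σ → σ ≗ start m) → ∀ {τ} → K′ τ → τ ≗ start (n + m))
  numeral-chain zero    {K} = K , [] , λ _ h → h
  numeral-chain (suc n) {K} with numeral-chain n {Image (cmd (inc 0)) K}
  ... | K′ , p , h = K′ , fm (letter-image (cmd (inc 0))) ∷ p , λ m e {τ} k →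
    subst (λ j → τ ≗ start j) (+-suc n m)
      (h (suc m) (λ (_ , k , x) → Run-deterministic x Run-inc (e k)) k)

  -- Each letter of the antecedent leads to its strongest postcondition, and by soundness `goal`
  -- leads from `Everything` into the last one. Since `goal` has a run, that set is inhabited, and
  -- an element records a run of `c`.
  derivable⇒halts : ∀ {R c n} → All Sound R → Derivable (query {S} n (suffix R c)) →
                    ∃ λ τ → Run c (start n) τ
  derivable⇒halts {R} {c} {n} sounds d with numeral-chain n {Image init Everything}
  ... | K , p , h with letter⁻ {goal} {Everything} {Image fin (Image (cmd c) K)} (sound d
    (fm (letter-image init) ∷ append p
      (fm (letter-image (cmd c)) ∷ fm (letter-image fin) ∷
       append (bangs-valid sounds _)
         -- An inhabited image under `fin` contains every state, so the token relates it to itself.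
         (token⁺ S (letter⁺ λ (_ , k , _) _ → _ , k , tt) ∷
          fm (cleanup-valid (copiers R) _) ∷ []))))
    {σ = λ _ → 0} {λ _ → 0} tt tt
  ... | _ , (_ , k , x) , _ = _ , Run-resp
    (λ s → trans (h 0 (λ (_ , _ , z) s → trans (z s) (sym (⊕-zero 0 _ s))) k s)
      (⊕-cong 0 (+-identityʳ n) (λ _ → refl) s))
    (λ _ → refl) x

rulesFor-sound : ∀ c → All Sound (rulesFor c)
rulesFor-sound c = All.++⁺ (cmdRules-sound _ c) (finRules-sound _)

-- Diagonalisation

checkZero : Rec 1 → Cmd
checkZero g = compile g (0 ∷ []) 1 ⨾ loop 1 (inc 1)

compile-evaluates : ∀ {g n y} → g ⟪ n ∷ [] ⟫⇓ y → Run (compile g (0 ∷ []) 1) (start n) (1 ↦ y ⊕ start n)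
compile-evaluates {g} {n} eval = run-compile g eval ((s≤s z≤n , ⊕-fresh refl) ∷ []) (Clean-⊕ {0} z≤n λ _ → refl)

checkZero-halts : ∀ {g n} → g ⟪ n ∷ [] ⟫⇓ 0 → ∃ λ τ → Run (checkZero g) (start n) τ
checkZero-halts {g} {n} eval =
  1 ↦ 0 ⊕ start n , (compile-evaluates eval ⨾ stop (test (⊕-fresh (Clean-⊕ {0} z≤n (λ _ → refl) ≤-refl)) λ _ → refl))

-- Each round makes the register positive again, so only a run that stops at once is finite.
loop-inc-diverges : ∀ {r σ τ} → Run (loop r (inc r)) σ τ → σ r ≡ 0
loop-inc-diverges (stop (test z _)) = z
loop-inc-diverges {r} (step {ρ = ρ} _ (mark h) x)
  with trans (sym (loop-inc-diverges x)) (trans (h r) (cong (_+ ρ r) (δ-diag r)))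
... | ()

checkZero-diverges : ∀ {g n τ} → g ⟪ n ∷ [] ⟫⇓ 1 → ¬ Run (checkZero g) (start n) τ
checkZero-diverges {g} {n} eval (x ⨾ y)
  with trans (sym (loop-inc-diverges y)) (trans (Run-deterministic x (compile-evaluates eval) (λ _ → refl) 1)
         (⊕-same 1 1 (start n)))
... | ()

-- A derivation of `sequent` would make `f` answer 1 and `c` diverge on `n`, although the model
-- makes it halt. So there is none, `f` answers 0, `c` halts, and the sequent is derivable after
-- all.
undecidable : ∀ S → DerivabilityUndecidable S mult
undecidable S (f , decides) =
  ¬derivable (halts⇒derivable {c = c} {n} (proj₂ (checkZero-halts (eval (proj₂ (decides sequent) ¬derivable)))))
  where
  s t : TreeTerm S mult
  s = fm (letter init)
  t = fm (letter (cmd (inc 0)))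

  g : Rec 1
  g = comp f (diagonalRec s t (letter goal) ∷ [])

  c : Cmd
  c = checkZero g

  Γ : MetaFormula S mult
  Γ = suffix (rulesFor c) c

  n : ℕ
  n = codeMetaFormula Γ

  sequent : Sequent S mult
  sequent = query n Γ

  eval : ∀ {y} → f ⟪ codeSequent sequent ∷ [] ⟫⇓ y → g ⟪ n ∷ [] ⟫⇓ y
  eval x = ⇓comp (diagonalRec-⇓ s t (letter goal) Γ ∷ []) x

  ¬derivable : ¬ Derivable sequent
  ¬derivable d = checkZero-diverges (eval (proj₁ (decides sequent) d))
    (proj₂ (derivable⇒halts (rulesFor-sound c) d))

theorem6 : DerivabilityUndecidable F₂₀₁₅ mult × DerivabilityUndecidable F₂₀₁₈ mult × DerivabilityUndecidable F₂₀₁₈⁻ mult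
theorem6 = undecidable F₂₀₁₅ , undecidable F₂₀₁₈ , undecidable F₂₀₁₈⁻
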